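{- Let $p$ be a prime, let $\alpha_1,\alpha_2,\dots$ be power series in $\mathbb{F}_p[[x]]$, and let $f\in\mathbb{F}_p[[x]]$ be a nonzero power series satisfying $\operatorname{dlog}_k(f)=\alpha_k$ for all $k\ge1$. If $\mathbb{F}_p(x)[\alpha_i]_{i\ge1}$ is an infinite extension of $\mathbb{F}_p(x)$, then $f$ is transcendental over $\mathbb{F}_p[x]$.
   Context: The higher (Hasse) derivatives $\partial_k$ on $\mathbb{F}_p((x))$ are the $\mathbb{F}_p$-linear operators with $\partial_k(x^n)=\binom{n}{k}x^{n-k}$ (formally $\frac{1}{k!}\frac{d^k}{dx^k}$). The higher logarithmic derivative is $\operatorname{dlog}_k(f)=\partial_k(f)/f$ for nonzero $f$. -}

module Defs where

open import Data.Nat using (ℕ; zero; suc; _+_; _*_; _∸_; _≤_)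
open import Data.Nat.Combinatorics using (_C_)
open import Data.List using (List; []; _∷_)
open import Data.List.Relation.Unary.All using (All)
open import Data.Vec using (Vec; zipWith; foldr′)
open import Data.Product using (Σ; ∃; _×_; _,_)
open import Relation.Binary.PropositionalEquality using (_≡_)

-- Congruence of natural numbers modulo p (elements of 𝔽_p are represented
-- by natural numbers; two naturals denote the same element iff congruent).
_≡[_]_ : ℕ → ℕ → ℕ → Set
a ≡[ p ] b = ∃ λ m → ∃ λ n → a + m * p ≡ b + n * p

-- Formal power series in 𝔽_p[[x]] : coefficient sequences (n ↦ coeff of xⁿ),
-- compared coefficientwise modulo p.
PS : Set
PS = ℕ → ℕ

_≈[_]_ : PS → ℕ → PS → Set
f ≈[ p ] g = ∀ n → f n ≡[ p ] g n

0ps : PS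
0ps _ = 0

1ps : PS
1ps zero    = 1
1ps (suc _) = 0

_+ps_ : PS → PS → PS
(f +ps g) n = f n + g n

sumTo : ℕ → (ℕ → ℕ) → ℕ
sumTo zero    g = g 0
sumTo (suc n) g = sumTo n g + g (suc n)

_*ps_ : PS → PS → PS
(f *ps g) n = sumTo n (λ i → f i * g (n ∸ i))

_^ps_ : PS → ℕ → PS
f ^ps zero    = 1ps
f ^ps (suc m) = f *ps (f ^ps m)

-- Hasse derivative ∂_k : ∂_k(xᵐ) = (m choose k) x^{m-k}, so the coefficient
-- of xⁿ in ∂_k f is ((n+k) choose k) · f_{n+k}.
hasse : ℕ → PS → PS
hasse k f n = ((n + k) C k) * f (n + k)

NonZeroPS : ℕ → PS → Set
NonZeroPS p f = ∃ λ n → (f n ≡[ p ] 0 → Data.Empty.⊥)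
  where import Data.Empty

-- Polynomials in 𝔽_p[x] as coefficient lists [c₀, c₁, …]
Poly : Set
Poly = List ℕ

lookupD : List ℕ → ℕ → ℕ
lookupD []       _       = 0
lookupD (c ∷ cs) zero    = c
lookupD (c ∷ cs) (suc n) = lookupD cs n

polyPS : Poly → PS
polyPS = lookupD

ZeroPoly : ℕ → Poly → Set
ZeroPoly p cs = All (λ c → c ≡[ p ] 0) cs

-- Polynomials in 𝔽_p[x][y] : list [P₀, P₁, …] meaning Σ_j P_j(x) yʲ
Poly2 : Set
Poly2 = List Poly

evalY : Poly2 → PS → PS
evalY P f = go 0 P
  where
  go : ℕ → Poly2 → PS
  go j []       = 0ps
  go j (c ∷ cs) = (polyPS c *ps (f ^ps j)) +ps go (suc j) cs

ZeroPoly2 : ℕ → Poly2 → Set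
ZeroPoly2 p P = All (ZeroPoly p) P

Transcendental : ℕ → PS → Set
Transcendental p f = ∀ (P : Poly2) → evalY P f ≈[ p ] 0ps → ZeroPoly2 p P

-- Elements of the ring 𝔽_p[x][α_i]_{i≥1}: finite sums of terms
-- c(x) · α_{i₁} ⋯ α_{iₘ}, a term being (c , [i₁, …, iₘ]) with every iⱼ ≥ 1
-- (index 0 in the list refers to α_1: we store iⱼ - 1).
Term : Set
Term = Poly × List ℕ

Elem : Set
Elem = List Term

monoPS : (ℕ → PS) → List ℕ → PS
monoPS α []       = 1ps
monoPS α (i ∷ is) = α (suc i) *ps monoPS α is

evalElem : (ℕ → PS) → Elem → PS
evalElem α []             = 0ps
evalElem α ((c , is) ∷ ts) = (polyPS c *ps monoPS α is) +ps evalElem α ts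

-- Linear independence over 𝔽_p[x] (equivalently over 𝔽_p(x), by clearing
-- denominators) of N elements.
LinIndep : ℕ → (ℕ → PS) → ∀ {N} → Vec Elem N → Set
LinIndep p α {N} es =
  ∀ (cs : Vec Poly N) →
    foldr′ _+ps_ 0ps (zipWith (λ c e → polyPS c *ps evalElem α e) cs es) ≈[ p ] 0ps →
    Data.Vec.Relation.Unary.All.All (ZeroPoly p) cs
  where import Data.Vec.Relation.Unary.All

InfiniteExt : ℕ → (ℕ → PS) → Set
InfiniteExt p α = ∀ (N : ℕ) → Σ (Vec Elem N) (λ es → LinIndep p α es)

{-# OPTIONS --safe #-}

-- Put K = 𝔽_p(x) and suppose f satisfies a nonzero polynomial relation of least
-- degree n, so that 1, f, …, fⁿ⁻¹ is a K-basis of K(f).  Let q = pᵐ > k.  A relation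
-- Σ cᵢ fⁱ^q = 0 splits, along the basis 1, x, …, x^(q-1) of 𝔽_p((x)) over its q-th
-- powers, into relations between the fⁱ; hence the fⁱ^q are also independent, and
-- f = Σ vᵢ fⁱ^q for some vᵢ ∈ K.  Since ∂_k is linear over q-th powers, this gives
-- ∂_k f = Σ ∂_k(vᵢ) fⁱ^q ∈ K(f).  Every element of K[αᵢ] therefore lands in K(f) after
-- multiplication by a power of f, so no n + 1 of them are independent over K.
-- Everything is done over 𝔽_p[x], with denominators cleared; zero is decidable there,
-- which keeps the argument constructive.
module Submission where

open import Defs
open import Level using (0ℓ)
open import Algebra.Bundles using (CommutativeRing; CommutativeSemiring; RawRing)
import Algebra.Morphism.RingMonomorphism as RingMonomorphism
open import Algebra.Morphism.Structures using (IsRingMonomorphism)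
open import Data.Empty using (⊥-elim)
open import Data.Fin using (Fin; zero; suc; toℕ; fromℕ; fromℕ<; inject₁; punchIn)
open import Data.Fin.Properties using (any?; toℕ<n; toℕ-fromℕ; toℕ-fromℕ<; toℕ-inject₁)
open import Data.Fin.Relation.Unary.Top using (view; ‵fromℕ; ‵inject₁)
open import Data.List as List using ([]; _∷_; applyUpTo)
open import Data.List.Relation.Unary.All using ([]; _∷_)
open import Data.Nat as ℕ using (ℕ; zero; suc)
import Data.Nat.Properties as ℕ
open import Data.Product using (Σ; ∃; _×_; _,_; proj₁; proj₂)
open import Data.Sum using (_⊎_; inj₁; inj₂)
open import Data.Vec as Vec using (Vec; zipWith; foldr′)
import Data.Vec.Functional as V
open import Data.Vec.Functional.Properties using (insertAt-lookup; insertAt-punchIn)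
import Data.Vec.Relation.Unary.All.Properties as VecAll
open import Function using (_∘_)
open import Relation.Binary.Bundles using (Setoid)
open import Relation.Binary.PropositionalEquality as ≡ using (_≡_; _≗_)
open import Relation.Nullary using (¬_; Dec; yes; no; ¬?; contradiction)
open import Relation.Nullary.Decidable using (decidable-stable; map′)

-- Linear algebra over a subring

-- That `f` is a combination of the `fⁱ^q` comes from a dimension count: they are `n` independent
-- members of a span of `n` elements, so an exchange argument applies. No relation of least degree
-- is searched for. Independence of `1, f, …, fⁿ⁻¹` is proved by induction on `n`, and a failure at
-- the next power supplies the basis and the algebraic relation at once. Vanishing of a general
-- power series cannot be tested, so scalars are kept apart from the series on which they act, and
-- only scalars are ever compared with zero. Inverses are avoided as well: elimination
-- cross-multiplies, a member of a span carries a nonzero polynomial denominator, and the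
-- denominators `f` of the `αᵢ` are recorded by an exponent, since `f` need not be a unit among the
-- power series.

module LinearSystems (D : CommutativeRing 0ℓ 0ℓ) where

  open CommutativeRing D hiding (zero)
  open import Algebra.Properties.Semiring.Sum semiring
  open import Algebra.Properties.Ring ring using (-‿distribˡ-*)
  open import Algebra.Solver.Ring.NaturalCoefficients.Default commutativeSemiring
    using (solve; _:+_; _:*_; _:=_)
  open import Relation.Binary.Reasoning.Setoid setoid

  ∑-zero : ∀ {n} (f : Fin n → Carrier) → (∀ i → f i ≈ 0#) → sum f ≈ 0#
  ∑-zero {n} f f≈0 = trans (sum-cong-≋ f≈0) (sum-replicate-zero n)

  module _ (1≉0 : ¬ 1# ≈ 0#) (_≟0 : ∀ x → Dec (x ≈ 0#))
    (cancel : ∀ x y → ¬ x ≈ 0# → x * y ≈ 0# → y ≈ 0#) where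

    kernel : ∀ n (v : Fin (suc n) → Fin n → Carrier) →
      Σ (Fin (suc n) → Carrier) λ a →
        (∃ λ j → ¬ a j ≈ 0#) × (∀ i → ∑[ j ≤ n ] (a j * v j i) ≈ 0#)
    kernel zero v = (λ _ → 1#) , (zero , 1≉0) , λ ()
    kernel (suc n) v with any? (λ j → ¬? (v j zero ≟0))
    ... | no all-zero =
      let a , (j , aj≉0) , a-solves = kernel n (λ j i → v (suc j) (suc i)) in
      0# V.∷ a , (suc j , aj≉0) , λ where
        zero → ∑-zero (λ j → (0# V.∷ a) j * v j zero) λ j →
          trans (*-congˡ (decidable-stable (v j zero ≟0) λ v≉0 → all-zero (j , v≉0))) (zeroʳ _)
        (suc i) → trans (+-cong (zeroˡ _) (a-solves i)) (+-identityˡ 0#)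
    ... | yes (j₀ , w≉0) = a′ , (punchIn j₀ j , a′≉0) , a′-solves
      where
      w : Carrier
      w = v j₀ zero

      u : Fin (suc n) → Fin (suc n) → Carrier
      u j i = v (punchIn j₀ j) i

      reduced : Fin (suc n) → Fin (suc n) → Carrier
      -- Cross-multiplication by the pivot clears the coordinate `zero` without dividing by `w`.
      reduced j i = - u j zero * v j₀ i + w * u j i

      solution = kernel n (λ j i → reduced j (suc i))

      a : Fin (suc n) → Carrier
      a = proj₁ solution

      j : Fin (suc n)
      j = proj₁ (proj₁ (proj₂ solution))

      s : Carrier
      -- The total weight with which the pivot vector enters the combination of the reduced vectors;
      -- the others enter with `w * a j`.
      s = ∑[ j ≤ n ] (a j * - u j zero)

      a′ : Fin (suc (suc n)) → Carrier
      a′ = V.insertAt (λ j → w * a j) j₀ s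

      a′≉0 : ¬ a′ (punchIn j₀ j) ≈ 0#
      a′≉0 a′≈0 = proj₂ (proj₁ (proj₂ solution))
        (cancel w (a j) w≉0 (trans (sym (reflexive (insertAt-punchIn (λ j → w * a j) j₀ s j))) a′≈0))

      collect : ∀ i → ∑[ j ≤ suc n ] (a′ j * v j i) ≈ ∑[ j ≤ n ] (a j * reduced j i)
      collect i = begin
        ∑[ j ≤ suc n ] (a′ j * v j i)
          ≈⟨ sum-remove {i = j₀} (λ j → a′ j * v j i) ⟩
        a′ j₀ * v j₀ i + ∑[ j ≤ n ] (a′ (punchIn j₀ j) * u j i)
          ≈⟨ +-cong (*-congʳ (reflexive (insertAt-lookup (λ j → w * a j) j₀ s)))
               (sum-cong-≋ {suc n} λ j → *-congʳ {u j i} (reflexive (insertAt-punchIn (λ j → w * a j) j₀ s j))) ⟩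
        s * v j₀ i + ∑[ j ≤ n ] (w * a j * u j i)
          ≈⟨ +-congʳ (*-distribʳ-sum (v j₀ i) (λ j → a j * - u j zero)) ⟩
        ∑[ j ≤ n ] (a j * - u j zero * v j₀ i) + ∑[ j ≤ n ] (w * a j * u j i)
          ≈⟨ ∑-distrib-+ (λ j → a j * - u j zero * v j₀ i) (λ j → w * a j * u j i) ⟨
        ∑[ j ≤ n ] (a j * - u j zero * v j₀ i + w * a j * u j i)
          ≈⟨ sum-cong-≋ {suc n} (λ j → solve 5
               (λ a m x w y → a :* m :* x :+ w :* a :* y := a :* (m :* x :+ w :* y))
               refl (a j) (- u j zero) (v j₀ i) w (u j i)) ⟩
        ∑[ j ≤ n ] (a j * reduced j i) ∎

      pivot-column : ∀ j → reduced j zero ≈ 0#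
      pivot-column j = begin
        - u j zero * w + w * u j zero   ≈⟨ +-cong (-‿distribˡ-* (u j zero) w) (*-comm (u j zero) w) ⟨
        - (u j zero * w) + u j zero * w ≈⟨ -‿inverseˡ (u j zero * w) ⟩
        0# ∎

      a′-solves : ∀ i → ∑[ j ≤ suc n ] (a′ j * v j i) ≈ 0#
      a′-solves zero = trans (collect zero)
        (∑-zero (λ j → a j * reduced j zero) λ j → trans (*-congˡ (pivot-column j)) (zeroʳ (a j)))
      a′-solves (suc i) = trans (collect (suc i)) (proj₂ (proj₂ solution) i)

module Subring (A : CommutativeRing 0ℓ 0ℓ) where

  open CommutativeRing A hiding (zero)
  open import Algebra.Properties.Semiring.Sum semiring
  open import Algebra.Properties.Ring ring using (-‿distribˡ-*)
  open import Algebra.Properties.Group +-group using (inverseˡ-unique)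
  open import Algebra.Solver.Ring.NaturalCoefficients.Default commutativeSemiring
    using (solve; _:+_; _:*_; _:=_)
  open import Relation.Binary.Reasoning.Setoid setoid

  -- Scalars are ring elements with a proof of `S`, so that they inherit equality and multiply
  -- arbitrary elements directly. Decidability of zero is asked of scalars only; `S-cancel` makes
  -- the whole ring torsion-free over them.
  module Spans
    (S : Carrier → Set)
    (S-0 : S 0#) (S-1 : S 1#)
    (S-+ : ∀ {x y} → S x → S y → S (x + y))
    (S-* : ∀ {x y} → S x → S y → S (x * y))
    (S-neg : ∀ {x} → S x → S (- x))
    (S-≟0 : ∀ {x} → S x → Dec (x ≈ 0#))
    (1≉0 : ¬ 1# ≈ 0#)
    (S-cancel : ∀ {x y} → S x → ¬ x ≈ 0# → x * y ≈ 0# → y ≈ 0#) where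

    Scalar : Set
    Scalar = Σ Carrier S

    ι : Scalar → Carrier
    ι = proj₁

    rawScalars : RawRing 0ℓ 0ℓ
    rawScalars = record
      { Carrier = Scalar
      ; _≈_ = λ x y → ι x ≈ ι y
      ; _+_ = λ (x , Sx) (y , Sy) → x + y , S-+ Sx Sy
      ; _*_ = λ (x , Sx) (y , Sy) → x * y , S-* Sx Sy
      ; -_  = λ (x , Sx) → - x , S-neg Sx
      ; 0#  = 0# , S-0
      ; 1#  = 1# , S-1
      }

    ι-isRingMonomorphism : IsRingMonomorphism rawScalars rawRing ι
    ι-isRingMonomorphism = record
      { isRingHomomorphism = record
        { isSemiringHomomorphism = record
          { isNearSemiringHomomorphism = record
            { +-isMonoidHomomorphism = record
              { isMagmaHomomorphism = record
                { isRelHomomorphism = record { cong = λ x≈y → x≈y }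
                ; homo = λ _ _ → refl
                }
              ; ε-homo = refl
              }
            ; *-homo = λ _ _ → refl
            }
          ; 1#-homo = refl
          }
        ; -‿homo = λ _ → refl
        }
      ; injective = λ x≈y → x≈y
      }

    scalars : CommutativeRing 0ℓ 0ℓ
    scalars = record
      { isCommutativeRing = RingMonomorphism.isCommutativeRing ι-isRingMonomorphism isCommutativeRing }

    module D = CommutativeRing scalars
    open import Algebra.Properties.Semiring.Sum D.semiring using () renaming (sum to D-sum)

    scalar-kernel = LinearSystems.kernel scalars 1≉0 (λ (_ , Sx) → S-≟0 Sx) (λ (_ , Sx) _ → S-cancel Sx)

    ι-sum : ∀ {n} (v : Fin n → Scalar) → ι (D-sum v) ≈ ∑[ i < n ] ι (v i)
    ι-sum {zero}  v = refl
    ι-sum {suc n} v = +-congˡ (ι-sum (V.tail v))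

    comb : ∀ {n} → (Fin n → Scalar) → (Fin n → Carrier) → Carrier
    comb v b = sum (λ i → ι (v i) * b i)

    comb-+ : ∀ {n} (v w : Fin n → Scalar) b →
      comb (λ i → v i D.+ w i) b ≈ comb v b + comb w b
    comb-+ v w b = trans (sum-cong-≋ λ i → distribʳ (b i) (ι (v i)) (ι (w i)))
      (∑-distrib-+ (λ i → ι (v i) * b i) (λ i → ι (w i) * b i))

    comb-* : ∀ {n} c (v : Fin n → Scalar) b → comb (λ i → c D.* v i) b ≈ ι c * comb v b
    comb-* c v b = trans (sum-cong-≋ λ i → *-assoc (ι c) (ι (v i)) (b i))
      (sym (*-distribˡ-sum (ι c) (λ i → ι (v i) * b i)))

    comb-cong : ∀ {n} (v : Fin n → Scalar) {b b′ : Fin n → Carrier} →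
      (∀ i → b i ≈ b′ i) → comb v b ≈ comb v b′
    comb-cong v b≈b′ = sum-cong-≋ λ i → *-congˡ (b≈b′ i)

    comb-zero : ∀ {n} (v : Fin n → Scalar) b → (∀ i → ι (v i) ≈ 0#) → comb v b ≈ 0#
    comb-zero {n} v b v≈0 = trans (sum-cong-≋ λ i → trans (*-congʳ (v≈0 i)) (zeroˡ (b i)))
      (sum-replicate-zero n)

    comb-*ʳ : ∀ {n} (v : Fin n → Scalar) b h → comb v (λ i → b i * h) ≈ comb v b * h
    comb-*ʳ v b h = trans (sum-cong-≋ λ i → sym (*-assoc (ι (v i)) (b i) h))
      (sym (*-distribʳ-sum h (λ i → ι (v i) * b i)))

    unit : ∀ {n} → Fin n → Fin n → Scalar
    unit zero    = D.1# V.∷ λ _ → D.0#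
    unit (suc i) = D.0# V.∷ unit i

    comb-unit : ∀ {n} (i : Fin n) b → comb (unit i) b ≈ b i
    comb-unit zero    b = trans (+-cong (*-identityˡ (b zero))
      (comb-zero (λ _ → D.0#) (V.tail b) λ _ → refl)) (+-identityʳ (b zero))
    comb-unit (suc i) b = trans (+-cong (zeroˡ (b zero)) (comb-unit i (V.tail b)))
      (+-identityˡ (b (suc i)))

    Independent : ∀ {n} → (Fin n → Carrier) → Set
    Independent b = ∀ v → comb v b ≈ 0# → ∀ i → ι (v i) ≈ 0#

    -- The span of b over the fraction field of the scalars.
    Span : ∀ {n} → (Fin n → Carrier) → Carrier → Set
    Span {n} b g = Σ Scalar λ c → ¬ ι c ≈ 0# × Σ (Fin n → Scalar) λ v → ι c * g ≈ comb v b

    *-≉0 : ∀ c d → ¬ ι c ≈ 0# → ¬ ι d ≈ 0# → ¬ ι (c D.* d) ≈ 0#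
    *-≉0 (_ , Sc) _ c≉0 d≉0 cd≈0 = d≉0 (S-cancel Sc c≉0 cd≈0)

    module _ {n} {b : Fin n → Carrier} where

      Span-cong : ∀ {g h} → g ≈ h → Span b g → Span b h
      Span-cong g≈h (c , c≉0 , v , cg≈vb) = c , c≉0 , v , trans (*-congˡ (sym g≈h)) cg≈vb

      Span-0 : Span b 0#
      Span-0 = D.1# , 1≉0 , (λ _ → D.0#) ,
        trans (zeroʳ 1#) (sym (comb-zero (λ _ → D.0#) b λ _ → refl))

      Span-basis : ∀ i → Span b (b i)
      Span-basis i = D.1# , 1≉0 , unit i , trans (*-identityˡ (b i)) (sym (comb-unit i b))

      Span-+ : ∀ {g h} → Span b g → Span b h → Span b (g + h)
      Span-+ {g} {h} (c , c≉0 , v , cg≈vb) (d , d≉0 , w , dh≈wb) =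
        c D.* d , *-≉0 c d c≉0 d≉0 , (λ i → (d D.* v i) D.+ (c D.* w i)) , (begin
          ι c * ι d * (g + h)                  ≈⟨ solve 4 (λ c d g h →
            c :* d :* (g :+ h) := d :* (c :* g) :+ c :* (d :* h)) refl (ι c) (ι d) g h ⟩
          ι d * (ι c * g) + ι c * (ι d * h)    ≈⟨ +-cong (*-congˡ cg≈vb) (*-congˡ dh≈wb) ⟩
          ι d * comb v b + ι c * comb w b      ≈⟨ +-cong (comb-* d v b) (comb-* c w b) ⟨
          comb (λ i → d D.* v i) b + comb (λ i → c D.* w i) b
                                               ≈⟨ comb-+ (λ i → d D.* v i) (λ i → c D.* w i) b ⟨
          comb (λ i → (d D.* v i) D.+ (c D.* w i)) b ∎)

      Span-scale : ∀ a {g} → Span b g → Span b (ι a * g)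
      Span-scale a {g} (c , c≉0 , v , cg≈vb) = c , c≉0 , (λ i → a D.* v i) , (begin
        ι c * (ι a * g)          ≈⟨ solve 3 (λ c a g → c :* (a :* g) := a :* (c :* g)) refl (ι c) (ι a) g ⟩
        ι a * (ι c * g)          ≈⟨ *-congˡ cg≈vb ⟩
        ι a * comb v b           ≈⟨ comb-* a v b ⟨
        comb (λ i → a D.* v i) b ∎)

      Span-unscale : ∀ a {g} → ¬ ι a ≈ 0# → Span b (ι a * g) → Span b g
      Span-unscale a {g} a≉0 (c , c≉0 , v , cag≈vb) =
        c D.* a , *-≉0 c a c≉0 a≉0 , v , trans (*-assoc (ι c) (ι a) g) cag≈vb

      Span-comb : ∀ {m} (v : Fin m → Scalar) (g : Fin m → Carrier) →
        (∀ i → Span b (g i)) → Span b (comb v g)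
      Span-comb {zero}  v g spans = Span-0
      Span-comb {suc m} v g spans =
        Span-+ (Span-scale (v zero) (spans zero)) (Span-comb (V.tail v) (V.tail g) λ i → spans (suc i))

      Span-*ʳ : ∀ {h} → (∀ i → Span b (b i * h)) → ∀ {g} → Span b g → Span b (g * h)
      Span-*ʳ {h} basis*h {g} (c , c≉0 , v , cg≈vb) = Span-unscale c c≉0
        (Span-cong (begin
          comb v (λ i → b i * h) ≈⟨ comb-*ʳ v b h ⟩
          comb v b * h           ≈⟨ *-congʳ cg≈vb ⟨
          ι c * g * h            ≈⟨ *-assoc (ι c) g h ⟩
          ι c * (g * h)          ∎)
          (Span-comb v (λ i → b i * h) basis*h))

      -- With denominators cleared, the `suc n` coefficient vectors over `b` have only `n`
      -- coordinates, so elimination finds a relation between them.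
      Span-dependent : (g : Fin (suc n) → Carrier) → (∀ j → Span b (g j)) →
        Σ (Fin (suc n) → Scalar) λ a → (∃ λ j → ¬ ι (a j) ≈ 0#) × comb a g ≈ 0#
      Span-dependent g spans =
        let a , (j , aj≉0) , a-solves = scalar-kernel n v in
        -- The vector `a` relates the multiples `ι (c j) * g j`, so each denominator moves into the
        -- coefficient.
        (λ j → a j D.* c j) ,
        (j , *-≉0 (a j) (c j) aj≉0 (proj₁ (proj₂ (spans j)))) ,
        (begin
          ∑[ j ≤ n ] (ι (a j) * ι (c j) * g j)
            ≈⟨ sum-cong-≋ {suc n} (λ j → trans (*-assoc (ι (a j)) (ι (c j)) (g j))
                 (*-congˡ {ι (a j)} (proj₂ (proj₂ (proj₂ (spans j)))))) ⟩
          ∑[ j ≤ n ] (ι (a j) * comb (v j) b)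
            ≈⟨ sum-cong-≋ {suc n} (λ j → *-distribˡ-sum (ι (a j)) (λ i → ι (v j i) * b i)) ⟩
          ∑[ j ≤ n ] ∑[ i < n ] (ι (a j) * (ι (v j i) * b i))
            ≈⟨ ∑-comm (λ j i → ι (a j) * (ι (v j i) * b i)) ⟩
          ∑[ i < n ] ∑[ j ≤ n ] (ι (a j) * (ι (v j i) * b i))
            ≈⟨ sum-cong-≋ {n} (λ i → column a i (a-solves i)) ⟩
          ∑[ i < n ] 0#
            ≈⟨ sum-replicate-zero n ⟩
          0# ∎)
        where
        c : Fin (suc n) → Scalar
        c j = proj₁ (spans j)
        v : Fin (suc n) → Fin n → Scalar
        v j = proj₁ (proj₂ (proj₂ (spans j)))

        column : ∀ (a : Fin (suc n) → Scalar) i → ι (D-sum (λ j → a j D.* v j i)) ≈ 0# →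
          ∑[ j ≤ n ] (ι (a j) * (ι (v j i) * b i)) ≈ 0#
        column a i solves = begin
          ∑[ j ≤ n ] (ι (a j) * (ι (v j i) * b i))
            ≈⟨ sum-cong-≋ {suc n} (λ j → *-assoc (ι (a j)) (ι (v j i)) (b i)) ⟨
          ∑[ j ≤ n ] (ι (a j) * ι (v j i) * b i)
            ≈⟨ *-distribʳ-sum (b i) (λ j → ι (a j) * ι (v j i)) ⟨
          (∑[ j ≤ n ] (ι (a j) * ι (v j i))) * b i
            ≈⟨ *-congʳ (ι-sum (λ j → a j D.* v j i)) ⟨
          ι (D-sum (λ j → a j D.* v j i)) * b i
            ≈⟨ *-congʳ solves ⟩
          0# * b i
            ≈⟨ zeroˡ (b i) ⟩
          0# ∎

    -- Steinitz exchange: `g` and the `n` members of `b′` all lie in a span of `n` elements, hence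
    -- are dependent. If the coefficient of `g` vanished, the relation would contradict the
    -- independence of `b′`; so it can serve as the denominator of `g`.
    Span-exchange : ∀ {n} (b b′ : Fin n → Carrier) → Independent b′ → (∀ i → Span b (b′ i)) →
      ∀ {g} → Span b g → Span b′ g
    Span-exchange b b′ indep spans {g} g∈b
      with Span-dependent {b = b} (g V.∷ b′) (λ { zero → g∈b ; (suc i) → spans i })
    ... | a , (j , aj≉0) , dep with S-≟0 (proj₂ (a zero))
    ...   | no a₀≉0 = a zero , a₀≉0 , (λ i → D.- D.1# D.* a (suc i)) , (begin
            ι (a zero) * g            ≈⟨ inverseˡ-unique (ι (a zero) * g) (comb (V.tail a) b′) dep ⟩
            - comb (V.tail a) b′      ≈⟨ -‿cong (*-identityˡ (comb (V.tail a) b′)) ⟨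
            - (1# * comb (V.tail a) b′) ≈⟨ -‿distribˡ-* 1# (comb (V.tail a) b′) ⟩
            - 1# * comb (V.tail a) b′ ≈⟨ comb-* (D.- D.1#) (V.tail a) b′ ⟨
            comb (λ i → D.- D.1# D.* a (suc i)) b′ ∎)
    ...   | yes a₀≈0 = ⊥-elim (aj≉0 (all-zero j))
            where
            all-zero : ∀ j → ι (a j) ≈ 0#
            all-zero zero    = a₀≈0
            all-zero (suc i) = indep (V.tail a) (begin
              comb (V.tail a) b′                  ≈⟨ +-identityˡ (comb (V.tail a) b′) ⟨
              0# + comb (V.tail a) b′             ≈⟨ +-congʳ (trans (*-congʳ a₀≈0) (zeroˡ g)) ⟨
              ι (a zero) * g + comb (V.tail a) b′ ≈⟨ dep ⟩
              0#                                  ∎) i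

    -- Algebras spanned by finitely many powers

    open import Algebra.Properties.Semiring.Exp semiring using (_^_; ^-homo-*; ^-congʳ)

    powers : ∀ {n} → Carrier → Fin n → Carrier
    powers f i = f ^ toℕ i

    module PowerSpan (f : Carrier) (n : ℕ) (f^n∈ : Span (powers {n} f) (f ^ n)) where

      V : Carrier → Set
      V = Span (powers {n} f)

      -- The case `k = n` is the algebraic relation itself. Exponents up to `n` suffice for closure
      -- under multiplication by `f`, which raises the exponent of a basis element by one.
      V-^ : ∀ {k} → k ℕ.≤ n → V (f ^ k)
      V-^ {k} k≤n with ℕ.m≤n⇒m<n∨m≡n k≤n
      ... | inj₁ k<n    = Span-cong (^-congʳ f (toℕ-fromℕ< k<n)) (Span-basis (fromℕ< k<n))
      ... | inj₂ ≡.refl = f^n∈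

      V-*f : ∀ {g} → V g → V (g * f)
      V-*f = Span-*ʳ λ i → Span-cong (*-comm f (f ^ toℕ i)) (V-^ (toℕ<n i))

      V-*f^ : ∀ k {g} → V g → V (f ^ k * g)
      V-*f^ zero    {g} g∈ = Span-cong (sym (*-identityˡ g)) g∈
      V-*f^ (suc k) {g} g∈ = Span-cong
        (solve 3 (λ f fk g → (fk :* g) :* f := (f :* fk) :* g) refl f (f ^ k) g)
        (V-*f (V-*f^ k g∈))

      V-1 : V 1#
      V-1 = V-^ ℕ.z≤n

      V-* : ∀ {g h} → V g → V h → V (g * h)
      V-* g∈ h∈ = Span-*ʳ (λ i → V-*f^ (toℕ i) h∈) g∈

      V-power : ∀ k {g} → V g → V (g ^ k)
      V-power zero    g∈ = V-1
      V-power (suc k) g∈ = V-* g∈ (V-power k g∈)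

      -- Membership in the localisation of `V` at `f`. A logarithmic derivative has denominator `f`,
      -- and no inverse of `f` is constructed.
      V[1/f] : Carrier → Set
      V[1/f] g = ∃ λ k → V (f ^ k * g)

      V[1/f]-+ : ∀ {g h} → V[1/f] g → V[1/f] h → V[1/f] (g + h)
      V[1/f]-+ {g} {h} (k , g∈) (l , h∈) = k ℕ.+ l ,
        Span-cong (begin
          f ^ l * (f ^ k * g) + f ^ k * (f ^ l * h)
            ≈⟨ solve 4 (λ x y g h → x :* (y :* g) :+ y :* (x :* h) := y :* x :* (g :+ h)) refl (f ^ l) (f ^ k) g h ⟩
          f ^ k * f ^ l * (g + h)
            ≈⟨ *-congʳ (^-homo-* f k l) ⟨
          f ^ (k ℕ.+ l) * (g + h) ∎)
        (Span-+ (V-*f^ l g∈) (V-*f^ k h∈))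

      V[1/f]-* : ∀ {g h} → V[1/f] g → V[1/f] h → V[1/f] (g * h)
      V[1/f]-* {g} {h} (k , g∈) (l , h∈) = k ℕ.+ l ,
        Span-cong (begin
          f ^ k * g * (f ^ l * h)
            ≈⟨ solve 4 (λ y g x h → y :* g :* (x :* h) := y :* x :* (g :* h)) refl (f ^ k) g (f ^ l) h ⟩
          f ^ k * f ^ l * (g * h)
            ≈⟨ *-congʳ (^-homo-* f k l) ⟨
          f ^ (k ℕ.+ l) * (g * h) ∎)
        (V-* g∈ h∈)

      V⇒V[1/f] : ∀ {g} → V g → V[1/f] g
      V⇒V[1/f] g∈ = 0 , V-*f^ 0 g∈

      -- A single power of `f` is needed so that it can be factored out of a linear relation and
      -- cancelled.
      common-exponent : ∀ {m} (g : Fin m → Carrier) → (∀ j → V[1/f] (g j)) →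
        ∃ λ k → ∀ j → V (f ^ k * g j)
      common-exponent {zero}  g g∈ = 0 , λ ()
      common-exponent {suc m} g g∈ =
        let l , l∈ = g∈ zero
            k , k∈ = common-exponent (V.tail g) (λ j → g∈ (suc j))
        in l ℕ.+ k , λ where
          zero → Span-cong (trans
            (solve 3 (λ x y g → x :* (y :* g) := y :* x :* g) refl (f ^ k) (f ^ l) (g zero))
            (*-congʳ (sym (^-homo-* f l k)))) (V-*f^ k l∈)
          (suc j) → Span-cong (trans (sym (*-assoc (f ^ l) (f ^ k) (g (suc j))))
            (*-congʳ (sym (^-homo-* f l k)))) (V-*f^ l (k∈ j))

open import Data.Nat
open import Data.Nat.Combinatorics
  using (_C_; nCk+nC[k+1]≡[n+1]C[k+1]; k>n⇒nCk≡0; nCn≡1; nCk≡nC[n∸k]; nC1≡n)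
open import Data.Nat.DivMod using (_/_; _%_; m≡m%n+[m/n]*n; m%n<n)
open import Data.Nat.Divisibility
open import Data.Nat.Primality using (Prime; euclidsLemma; prime⇒nonZero; prime⇒nonTrivial)
open import Data.Nat.Properties
open import Data.Nat.Tactic.RingSolver using (solve-∀)
open ≡ using (refl; sym; trans; cong; cong₂; subst; module ≡-Reasoning)

-- The ring of power series modulo p

tail : PS → PS
tail f = f ∘ suc

scale : ℕ → PS → PS
scale c f n = c * f n

sumTo-suc : ∀ n g → sumTo (suc n) g ≡ g 0 + sumTo n (g ∘ suc)
sumTo-suc zero    g = refl
sumTo-suc (suc n) g = trans (cong (_+ g (2 + n)) (sumTo-suc n g)) (+-assoc (g 0) _ _)

-- Comes from `f = f 0 + x · tail f`. With it the ring laws reduce to inductions on the coefficient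
-- index and need no reindexing of double sums.
*ps-suc : ∀ f g n → (f *ps g) (suc n) ≡ f 0 * g (suc n) + (tail f *ps g) n
*ps-suc f g n = sumTo-suc n (λ i → f i * g (suc n ∸ i))

*ps-sucʳ : ∀ f g n → (f *ps g) (suc n) ≡ f (suc n) * g 0 + (f *ps tail g) n
*ps-sucʳ f g zero    = +-comm (f 0 * g 1) (f 1 * g 0)
*ps-sucʳ f g (suc n) = begin
  (f *ps g) (2 + n)                                                 ≡⟨ *ps-suc f g (suc n) ⟩
  f 0 * g (2 + n) + (tail f *ps g) (suc n)                          ≡⟨ cong (f 0 * g (2 + n) +_) (*ps-sucʳ (tail f) g n) ⟩
  f 0 * g (2 + n) + (f (2 + n) * g 0 + (tail f *ps tail g) n)       ≡⟨ swap (f 0 * g (2 + n)) (f (2 + n) * g 0) _ ⟩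
  f (2 + n) * g 0 + (f 0 * g (2 + n) + (tail f *ps tail g) n)       ≡⟨ cong (f (2 + n) * g 0 +_) (*ps-suc f (tail g) n) ⟨
  f (2 + n) * g 0 + (f *ps tail g) (suc n)                          ∎
  where
  open ≡-Reasoning
  swap : ∀ a b c → a + (b + c) ≡ b + (a + c)
  swap = solve-∀

*ps-cong-≗ : ∀ {f f′} g → f ≗ f′ → f *ps g ≗ f′ *ps g
*ps-cong-≗ g f≗f′ zero = cong (_* g 0) (f≗f′ 0)
*ps-cong-≗ {f} {f′} g f≗f′ (suc n) = begin
  (f *ps g) (suc n)                    ≡⟨ *ps-suc f g n ⟩
  f 0 * g (suc n) + (tail f *ps g) n   ≡⟨ cong₂ _+_ (cong (_* g (suc n)) (f≗f′ 0)) (*ps-cong-≗ g (f≗f′ ∘ suc) n) ⟩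
  f′ 0 * g (suc n) + (tail f′ *ps g) n ≡⟨ *ps-suc f′ g n ⟨
  (f′ *ps g) (suc n)                   ∎
  where open ≡-Reasoning

*ps-comm-≗ : ∀ f g → f *ps g ≗ g *ps f
*ps-comm-≗ f g zero    = *-comm (f 0) (g 0)
*ps-comm-≗ f g (suc n) = begin
  (f *ps g) (suc n)                  ≡⟨ *ps-suc f g n ⟩
  f 0 * g (suc n) + (tail f *ps g) n ≡⟨ cong₂ _+_ (*-comm (f 0) (g (suc n))) (*ps-comm-≗ (tail f) g n) ⟩
  g (suc n) * f 0 + (g *ps tail f) n ≡⟨ *ps-sucʳ g f n ⟨
  (g *ps f) (suc n)                  ∎
  where open ≡-Reasoning

*ps-distribʳ-≗ : ∀ h f g → (f +ps g) *ps h ≗ (f *ps h) +ps (g *ps h)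
*ps-distribʳ-≗ h f g zero    = *-distribʳ-+ (h 0) (f 0) (g 0)
*ps-distribʳ-≗ h f g (suc n) = begin
  ((f +ps g) *ps h) (suc n)
    ≡⟨ *ps-suc (f +ps g) h n ⟩
  (f 0 + g 0) * h (suc n) + ((tail f +ps tail g) *ps h) n
    ≡⟨ cong ((f 0 + g 0) * h (suc n) +_) (*ps-distribʳ-≗ h (tail f) (tail g) n) ⟩
  (f 0 + g 0) * h (suc n) + ((tail f *ps h) n + (tail g *ps h) n)
    ≡⟨ interchange (f 0) (g 0) (h (suc n)) _ _ ⟩
  (f 0 * h (suc n) + (tail f *ps h) n) + (g 0 * h (suc n) + (tail g *ps h) n)
    ≡⟨ cong₂ _+_ (*ps-suc f h n) (*ps-suc g h n) ⟨
  ((f *ps h) +ps (g *ps h)) (suc n) ∎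
  where
  open ≡-Reasoning
  interchange : ∀ a b c d e → (a + b) * c + (d + e) ≡ (a * c + d) + (b * c + e)
  interchange = solve-∀

scale-*ps : ∀ c f g → scale c f *ps g ≗ scale c (f *ps g)
scale-*ps c f g zero    = *-assoc c (f 0) (g 0)
scale-*ps c f g (suc n) = begin
  (scale c f *ps g) (suc n)                            ≡⟨ *ps-suc (scale c f) g n ⟩
  c * f 0 * g (suc n) + (scale c (tail f) *ps g) n     ≡⟨ cong (c * f 0 * g (suc n) +_) (scale-*ps c (tail f) g n) ⟩
  c * f 0 * g (suc n) + c * (tail f *ps g) n           ≡⟨ factor c (f 0) (g (suc n)) _ ⟩
  c * (f 0 * g (suc n) + (tail f *ps g) n)             ≡⟨ cong (c *_) (*ps-suc f g n) ⟨
  c * (f *ps g) (suc n)                                ∎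
  where
  open ≡-Reasoning
  factor : ∀ c a b d → c * a * b + c * d ≡ c * (a * b + d)
  factor = solve-∀

*ps-assoc-≗ : ∀ f g h → (f *ps g) *ps h ≗ f *ps (g *ps h)
*ps-assoc-≗ f g h zero    = *-assoc (f 0) (g 0) (h 0)
*ps-assoc-≗ f g h (suc n) = begin
  ((f *ps g) *ps h) (suc n)
    ≡⟨ *ps-suc (f *ps g) h n ⟩
  f 0 * g 0 * h (suc n) + (tail (f *ps g) *ps h) n
    ≡⟨ cong (f 0 * g 0 * h (suc n) +_) (*ps-cong-≗ h (*ps-suc f g) n) ⟩
  f 0 * g 0 * h (suc n) + ((scale (f 0) (tail g) +ps (tail f *ps g)) *ps h) n
    ≡⟨ cong (f 0 * g 0 * h (suc n) +_) (*ps-distribʳ-≗ h (scale (f 0) (tail g)) (tail f *ps g) n) ⟩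
  f 0 * g 0 * h (suc n) + ((scale (f 0) (tail g) *ps h) n + ((tail f *ps g) *ps h) n)
    ≡⟨ cong (f 0 * g 0 * h (suc n) +_) (cong₂ _+_ (scale-*ps (f 0) (tail g) h n) (*ps-assoc-≗ (tail f) g h n)) ⟩
  f 0 * g 0 * h (suc n) + (f 0 * (tail g *ps h) n + (tail f *ps (g *ps h)) n)
    ≡⟨ factor (f 0) (g 0) (h (suc n)) _ _ ⟩
  f 0 * (g 0 * h (suc n) + (tail g *ps h) n) + (tail f *ps (g *ps h)) n
    ≡⟨ cong (λ x → f 0 * x + (tail f *ps (g *ps h)) n) (*ps-suc g h n) ⟨
  f 0 * (g *ps h) (suc n) + (tail f *ps (g *ps h)) n
    ≡⟨ *ps-suc f (g *ps h) n ⟨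
  (f *ps (g *ps h)) (suc n) ∎
  where
  open ≡-Reasoning
  factor : ∀ a b c d e → a * b * c + (a * d + e) ≡ a * (b * c + d) + e
  factor = solve-∀

0ps-*ps : ∀ g → 0ps *ps g ≗ 0ps
0ps-*ps g zero    = refl
0ps-*ps g (suc n) = trans (*ps-suc 0ps g n) (0ps-*ps g n)

*ps-identityˡ-≗ : ∀ g → 1ps *ps g ≗ g
*ps-identityˡ-≗ g zero    = *-identityˡ (g 0)
*ps-identityˡ-≗ g (suc n) = trans (*ps-suc 1ps g n)
  (trans (cong₂ _+_ (*-identityˡ (g (suc n))) (0ps-*ps g n)) (+-identityʳ (g (suc n))))

module Mod (p : ℕ) where

  infix 4 _≡ₚ_ _≈ₚ_
  _≡ₚ_ : ℕ → ℕ → Set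
  a ≡ₚ b = a ≡[ p ] b

  _≈ₚ_ : PS → PS → Set
  f ≈ₚ g = f ≈[ p ] g

  ≡⇒≡ₚ : ∀ {a b} → a ≡ b → a ≡ₚ b
  ≡⇒≡ₚ a≡b = 0 , 0 , cong (_+ 0) a≡b

  ≡ₚ-refl : ∀ {a} → a ≡ₚ a
  ≡ₚ-refl = ≡⇒≡ₚ refl

  ≡ₚ-sym : ∀ {a b} → a ≡ₚ b → b ≡ₚ a
  ≡ₚ-sym (m , n , e) = n , m , sym e

  ≡ₚ-trans : ∀ {a b c} → a ≡ₚ b → b ≡ₚ c → a ≡ₚ c
  ≡ₚ-trans {a} {b} {c} (m , n , e) (k , l , e′) = m + k , l + n , (begin
    a + (m + k) * p     ≡⟨ shuffle₁ a m k p ⟩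
    (a + m * p) + k * p ≡⟨ cong (_+ k * p) e ⟩
    (b + n * p) + k * p ≡⟨ shuffle₂ b n k p ⟩
    (b + k * p) + n * p ≡⟨ cong (_+ n * p) e′ ⟩
    (c + l * p) + n * p ≡⟨ shuffle₁ c l n p ⟨
    c + (l + n) * p     ∎)
    where
    open ≡-Reasoning
    shuffle₁ : ∀ a m k p → a + (m + k) * p ≡ (a + m * p) + k * p
    shuffle₁ = solve-∀
    shuffle₂ : ∀ a m k p → (a + m * p) + k * p ≡ (a + k * p) + m * p
    shuffle₂ = solve-∀

  +-congₚ : ∀ {a b c d} → a ≡ₚ b → c ≡ₚ d → a + c ≡ₚ b + d
  +-congₚ {a} {b} {c} {d} (m , n , e) (k , l , e′) = m + k , n + l , (begin
    a + c + (m + k) * p       ≡⟨ shuffle a c m k p ⟩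
    (a + m * p) + (c + k * p) ≡⟨ cong₂ _+_ e e′ ⟩
    (b + n * p) + (d + l * p) ≡⟨ shuffle b d n l p ⟨
    b + d + (n + l) * p       ∎)
    where
    open ≡-Reasoning
    shuffle : ∀ a c m k p → a + c + (m + k) * p ≡ (a + m * p) + (c + k * p)
    shuffle = solve-∀

  *-congₚ : ∀ {a b c d} → a ≡ₚ b → c ≡ₚ d → a * c ≡ₚ b * d
  *-congₚ {a} {b} {c} {d} (m , n , e) (k , l , e′) =
    a * k + m * c + m * k * p , b * l + n * d + n * l * p , (begin
    a * c + (a * k + m * c + m * k * p) * p ≡⟨ shuffle a c m k p ⟩
    (a + m * p) * (c + k * p)               ≡⟨ cong₂ _*_ e e′ ⟩
    (b + n * p) * (d + l * p)               ≡⟨ shuffle b d n l p ⟨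
    b * d + (b * l + n * d + n * l * p) * p ∎)
    where
    open ≡-Reasoning
    shuffle : ∀ a c m k p → a * c + (a * k + m * c + m * k * p) * p ≡ (a + m * p) * (c + k * p)
    shuffle = solve-∀

  ∣⇒≡ₚ0 : ∀ {a} → p ∣ a → a ≡ₚ 0
  ∣⇒≡ₚ0 {a} (divides k a≡kp) = 0 , k , trans (+-identityʳ a) a≡kp

  ≡ₚ0⇒∣ : ∀ {a} → a ≡ₚ 0 → p ∣ a
  ≡ₚ0⇒∣ {a} (m , n , e) = ∣m+n∣m⇒∣n (subst (p ∣_) (trans (sym e) (+-comm a (m * p))) (n∣m*n n)) (n∣m*n m)

  _≟ₚ0 : ∀ a → Dec (a ≡ₚ 0)
  a ≟ₚ0 = map′ ∣⇒≡ₚ0 ≡ₚ0⇒∣ (p ∣? a)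

  *-≡ₚ0ˡ : ∀ {a} b → a ≡ₚ 0 → a * b ≡ₚ 0
  *-≡ₚ0ˡ b a≡0 = *-congₚ a≡0 (≡ₚ-refl {b})

  *-≡ₚ0ʳ : ∀ a {b} → b ≡ₚ 0 → a * b ≡ₚ 0
  *-≡ₚ0ʳ a b≡0 = ≡ₚ-trans (*-congₚ (≡ₚ-refl {a}) b≡0) (≡⇒≡ₚ (*-zeroʳ a))

  ≡ₚ-setoid : Setoid 0ℓ 0ℓ
  ≡ₚ-setoid = record
    { Carrier = ℕ ; _≈_ = _≡ₚ_
    ; isEquivalence = record { refl = ≡ₚ-refl ; sym = ≡ₚ-sym ; trans = ≡ₚ-trans } }

  *ps-cong : ∀ {f f′ g g′} → f ≈ₚ f′ → g ≈ₚ g′ → f *ps g ≈ₚ f′ *ps g′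
  *ps-cong f≈f′ g≈g′ zero = *-congₚ (f≈f′ 0) (g≈g′ 0)
  *ps-cong {f} {f′} {g} {g′} f≈f′ g≈g′ (suc n) = begin
    (f *ps g) (suc n)                      ≡⟨ *ps-suc f g n ⟩
    f 0 * g (suc n) + (tail f *ps g) n     ≈⟨ +-congₚ (*-congₚ (f≈f′ 0) (g≈g′ (suc n)))
                                               (*ps-cong {tail f} {tail f′} (f≈f′ ∘ suc) g≈g′ n) ⟩
    f′ 0 * g′ (suc n) + (tail f′ *ps g′) n ≡⟨ *ps-suc f′ g′ n ⟨
    (f′ *ps g′) (suc n)                    ∎
    where open import Relation.Binary.Reasoning.Setoid ≡ₚ-setoid

  ≗⇒≈ₚ : ∀ {f g} → f ≗ g → f ≈ₚ g
  ≗⇒≈ₚ f≗g n = ≡⇒≡ₚ (f≗g n)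

  -- Coefficients are natural numbers, so -1 is represented by `pred p`.
  negps : PS → PS
  negps = scale (pred p)

  psRing : .{{NonZero p}} → CommutativeRing 0ℓ 0ℓ
  psRing = record
    { Carrier = PS ; _≈_ = _≈ₚ_ ; _+_ = _+ps_ ; _*_ = _*ps_ ; -_ = negps ; 0# = 0ps ; 1# = 1ps
    ; isCommutativeRing = record
      { isRing = record
        { +-isAbelianGroup = record
          { isGroup = record
            { isMonoid = record
              { isSemigroup = record
                { isMagma = record
                  { isEquivalence = record
                    { refl = λ _ → ≡ₚ-refl
                    ; sym = λ f≈g n → ≡ₚ-sym (f≈g n)
                    ; trans = λ f≈g g≈h n → ≡ₚ-trans (f≈g n) (g≈h n)
                    }
                  ; ∙-cong = λ f≈f′ g≈g′ n → +-congₚ (f≈f′ n) (g≈g′ n)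
                  }
                ; assoc = λ f g h → ≗⇒≈ₚ λ n → +-assoc (f n) (g n) (h n)
                }
              ; identity = (λ f → ≗⇒≈ₚ λ n → refl) , (λ f → ≗⇒≈ₚ λ n → +-identityʳ (f n))
              }
            ; inverse = (λ f n → ≡ₚ-trans (≡⇒≡ₚ (+-comm (pred p * f n) (f n))) (p*≡ₚ0 (f n)))
                      , (λ f n → p*≡ₚ0 (f n))
            ; ⁻¹-cong = λ f≈g n → *-congₚ (≡ₚ-refl {pred p}) (f≈g n)
            }
          ; comm = λ f g → ≗⇒≈ₚ λ n → +-comm (f n) (g n)
          }
        ; *-cong = λ {f} {f′} {g} {g′} → *ps-cong {f} {f′} {g} {g′}
        ; *-assoc = λ f g h → ≗⇒≈ₚ (*ps-assoc-≗ f g h)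
        ; *-identity = (λ f → ≗⇒≈ₚ (*ps-identityˡ-≗ f))
                     , (λ f → ≗⇒≈ₚ λ n → trans (*ps-comm-≗ f 1ps n) (*ps-identityˡ-≗ f n))
        ; distrib = (λ h f g → ≗⇒≈ₚ λ n → trans (*ps-comm-≗ h (f +ps g) n)
                      (trans (*ps-distribʳ-≗ h f g n) (cong₂ _+_ (*ps-comm-≗ f h n) (*ps-comm-≗ g h n))))
                  , (λ h f g → ≗⇒≈ₚ (*ps-distribʳ-≗ h f g))
        }
      ; *-comm = λ f g → ≗⇒≈ₚ (*ps-comm-≗ f g)
      }
    }
    where
    p*≡ₚ0 : ∀ a → a + pred p * a ≡ₚ 0
    p*≡ₚ0 a = ∣⇒≡ₚ0 (divides a (trans (cong (_* a) (suc-pred p)) (*-comm p a)))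

-- Binomial coefficients modulo p

nC0≡1 : ∀ n → n C 0 ≡ 1
nC0≡1 n = trans (nCk≡nC[n∸k] {0} {n} z≤n) (nCn≡1 n)

absorption : ∀ n k → suc k * (suc n C suc k) ≡ suc n * (n C k)
absorption n zero = trans (cong (1 *_) (nC1≡n (suc n)))
  (trans (*-comm 1 (suc n)) (cong (suc n *_) (sym (nC0≡1 n))))
absorption zero (suc k) = trans
  (cong (suc (suc k) *_) (k>n⇒nCk≡0 {1} {suc (suc k)} (s≤s (s≤s z≤n))))
  (trans (*-zeroʳ (suc (suc k))) (cong (1 *_) (sym (k>n⇒nCk≡0 {0} {suc k} (s≤s z≤n)))))
absorption (suc n) (suc k) = begin
  suc (suc k) * (suc (suc n) C suc (suc k))
    ≡⟨ cong (suc (suc k) *_) (nCk+nC[k+1]≡[n+1]C[k+1] (suc n) (suc k)) ⟨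
  suc (suc k) * (c + (suc n C suc (suc k)))
    ≡⟨ expand k c _ ⟩
  c + (suc k * c + suc (suc k) * (suc n C suc (suc k)))
    ≡⟨ cong (c +_) (cong₂ _+_ (absorption n k) (absorption n (suc k))) ⟩
  c + (suc n * (n C k) + suc n * (n C suc k))
    ≡⟨ cong (c +_) (*-distribˡ-+ (suc n) (n C k) (n C suc k)) ⟨
  c + suc n * ((n C k) + (n C suc k))
    ≡⟨ cong (λ x → c + suc n * x) (nCk+nC[k+1]≡[n+1]C[k+1] n k) ⟩
  suc (suc n) * c ∎
  where
  open ≡-Reasoning
  c = suc n C suc k
  expand : ∀ k c d → suc (suc k) * (c + d) ≡ c + (suc k * c + suc (suc k) * d)
  expand = solve-∀

module _ {p} (p-prime : Prime p) where

  private instance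
    p≢0 : NonZero p
    p≢0 = prime⇒nonZero p-prime

  open Mod p

  -- Each factor `p` must divide `k` by Euclid's lemma, and is cancelled before the next one is
  -- treated.
  p^m∣kc⇒p^m∣k : ∀ m k c → ¬ p ∣ c → p ^ m ∣ k * c → p ^ m ∣ k
  p^m∣kc⇒p^m∣k zero    k c p∤c _ = 1∣ k
  p^m∣kc⇒p^m∣k (suc m) k c p∤c pᵐ⁺¹∣kc
    with euclidsLemma k c p-prime (m*n∣⇒m∣ p (p ^ m) pᵐ⁺¹∣kc)
  ... | inj₂ p∣c = contradiction p∣c p∤c
  ... | inj₁ (divides k′ refl) = subst (p ^ suc m ∣_) (*-comm p k′) (*-monoʳ-∣ p
    (p^m∣kc⇒p^m∣k m k′ c p∤c (*-cancelˡ-∣ p (subst (p ^ suc m ∣_) (rearrange k′ p c) pᵐ⁺¹∣kc))))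
    where
    rearrange : ∀ k p c → k * p * c ≡ p * (k * c)
    rearrange = solve-∀

  -- By `absorption`, `p ^ m` divides `k * ((p ^ m) C k)`. If the binomial were prime to `p`, then
  -- `p ^ m` would divide the smaller positive number `k`.
  p∣[p^m]Ck : ∀ m k → 0 < k → k < p ^ m → p ∣ (p ^ m) C k
  p∣[p^m]Ck m (suc k) _ k<q with p ∣? ((p ^ m) C suc k)
  ... | yes p∣c = p∣c
  ... | no  p∤c = contradiction (∣⇒≤ (p^m∣kc⇒p^m∣k m (suc k) _ p∤c (q∣ (p ^ m) k<q))) (<⇒≱ k<q)
    where
    q∣ : ∀ q → suc k < q → q ∣ suc k * (q C suc k)
    q∣ (suc q) _ = subst (suc q ∣_) (sym (absorption q k)) (m∣m*n (q C k))

  -- For `q = p ^ m` this compares coefficients below degree `q` in (1+x)^(a+q) ≡ (1+x)^a (1+x^q).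
  -- Pascal's rule carries the case `a = 0` to every `a`.
  [a+p^m]Ck : ∀ m a k → k < p ^ m → ((a + p ^ m) C k) ≡ₚ (a C k)
  [a+p^m]Ck m a zero _ = ≡⇒≡ₚ (trans (nC0≡1 (a + p ^ m)) (sym (nC0≡1 a)))
  [a+p^m]Ck m zero (suc k) k<q = ≡ₚ-trans (∣⇒≡ₚ0 (p∣[p^m]Ck m (suc k) z<s k<q))
    (≡⇒≡ₚ (sym (k>n⇒nCk≡0 {0} {suc k} z<s)))
  [a+p^m]Ck m (suc a) (suc k) k<q = ≡ₚ-trans
    (≡⇒≡ₚ (sym (nCk+nC[k+1]≡[n+1]C[k+1] (a + p ^ m) k)))
    (≡ₚ-trans (+-congₚ ([a+p^m]Ck m a k (<⇒≤ k<q)) ([a+p^m]Ck m a (suc k) k<q))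
      (≡⇒≡ₚ (nCk+nC[k+1]≡[n+1]C[k+1] a k)))

  [a+sp^m]Ck : ∀ m s a k → k < p ^ m → ((a + s * p ^ m) C k) ≡ₚ (a C k)
  [a+sp^m]Ck m zero    a k _   = ≡⇒≡ₚ (cong (_C k) (+-identityʳ a))
  [a+sp^m]Ck m (suc s) a k k<q = ≡ₚ-trans
    (≡⇒≡ₚ (cong (_C k) (sym (+-assoc a (p ^ m) (s * p ^ m)))))
    (≡ₚ-trans ([a+sp^m]Ck m s (a + p ^ m) k k<q) ([a+p^m]Ck m a k k<q))

-- Frobenius and Hasse derivatives

module Frobenius (R : CommutativeSemiring 0ℓ 0ℓ) where

  private module R = CommutativeSemiring R
  open R using (Carrier; _≈_; 0#; semiring)
  open import Algebra.Properties.Semiring.Sum semiring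
  open import Algebra.Properties.Semiring.Mult semiring renaming (_×_ to _×ʳ_)
  open import Algebra.Properties.Semiring.Exp semiring using (^-congʳ) renaming (_^_ to _^ʳ_)
  open import Algebra.Properties.CommutativeSemiring.Binomial R
  open import Relation.Binary.Reasoning.Setoid R.setoid

  module _ (p : ℕ) (0<p : 0 < p) (p×≈0 : ∀ x → p ×ʳ x ≈ 0#)
    (p∣pCk : ∀ k → 0 < k → k < p → p ∣ p C k) where

    p∣⇒×≈0 : ∀ {m} x → p ∣ m → m ×ʳ x ≈ 0#
    p∣⇒×≈0 x (divides k refl) = begin
      (k * p) ×ʳ x  ≈⟨ ×-congˡ {x} (*-comm k p) ⟩
      (p * k) ×ʳ x  ≈⟨ ×-assocˡ x p k ⟨
      p ×ʳ (k ×ʳ x) ≈⟨ p×≈0 (k ×ʳ x) ⟩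
      0#            ∎

    +-^p : ∀ x y → (x R.+ y) ^ʳ p ≈ x ^ʳ p R.+ y ^ʳ p
    +-^p x y = helper p 0<p refl
      where
      -- The exponent is generalised so that it can be matched as `suc r`, which separates the two
      -- outer binomial terms from those that vanish.
      helper : ∀ q → 0 < q → q ≡ p → (x R.+ y) ^ʳ q ≈ x ^ʳ q R.+ y ^ʳ q
      helper q@(suc r) _ refl = begin
        (x R.+ y) ^ʳ q
          ≈⟨ theorem q x y ⟩
        t zero R.+ ∑[ k ≤ r ] t (suc k)
          ≈⟨ R.+-congˡ (sum-init-last (t ∘ suc)) ⟩
        t zero R.+ (∑[ k < r ] t (suc (inject₁ k)) R.+ t (fromℕ q))
          ≈⟨ R.+-cong first (R.+-cong (R.trans (sum-cong-≋ inner) (sum-replicate-zero r)) last) ⟩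
        y ^ʳ q R.+ (0# R.+ x ^ʳ q)
          ≈⟨ R.+-congˡ (R.+-identityˡ _) ⟩
        y ^ʳ q R.+ x ^ʳ q
          ≈⟨ R.+-comm _ _ ⟩
        x ^ʳ q R.+ y ^ʳ q ∎
        where
        t : Fin (suc q) → Carrier
        t = binomialTerm x y q

        first : t zero ≈ y ^ʳ q
        first = R.trans (×-congˡ (nC0≡1 q)) (R.trans (×-homo-1 _) (R.*-identityˡ _))

        inner : ∀ k → t (suc (inject₁ k)) ≈ 0#
        inner k = p∣⇒×≈0 _ (p∣pCk (suc (toℕ (inject₁ k))) z<s
          (s<s (subst (_< r) (sym (toℕ-inject₁ k)) (toℕ<n k))))

        last : t (fromℕ q) ≈ x ^ʳ q
        last = begin
          (q C toℕ (fromℕ q)) ×ʳ (x ^ʳ toℕ (fromℕ q) R.* y ^ʳ (q ∸ toℕ (fromℕ q)))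
            ≡⟨ cong (λ k → (q C k) ×ʳ (x ^ʳ k R.* y ^ʳ (q ∸ k))) (toℕ-fromℕ q) ⟩
          (q C q) ×ʳ (x ^ʳ q R.* y ^ʳ (q ∸ q))
            ≈⟨ ×-congˡ (nCn≡1 q) ⟩
          1 ×ʳ (x ^ʳ q R.* y ^ʳ (q ∸ q))
            ≈⟨ ×-homo-1 _ ⟩
          x ^ʳ q R.* y ^ʳ (q ∸ q)
            ≈⟨ R.*-congˡ (^-congʳ y (n∸n≡0 q)) ⟩
          x ^ʳ q R.* R.1#
            ≈⟨ R.*-identityʳ _ ⟩
          x ^ʳ q ∎

module PrimePS (p : ℕ) (p-prime : Prime p) where

  instance
    p≢0 : NonZero p
    p≢0 = prime⇒nonZero p-prime

  open Mod p public

  module A = CommutativeRing psRing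
  open import Algebra.Properties.Semiring.Exp A.semiring public
    using (^-assocʳ; ^-congˡ) renaming (_^_ to infixr 30 _^ᴬ_)
  open import Algebra.Properties.CommutativeSemiring.Exp A.commutativeSemiring public
    using (^-distrib-*)
  open import Algebra.Properties.Semiring.Mult A.semiring using () renaming (_×_ to _×ᴬ_)

  0<p : 0 < p
  0<p = n≢0⇒n>0 (≢-nonZero⁻¹ p)

  1≢ₚ0 : ¬ 1 ≡ₚ 0
  1≢ₚ0 1≡0 = contradiction (∣1⇒≡1 (≡ₚ0⇒∣ 1≡0)) (λ { refl → 1-not-prime (prime⇒nonTrivial p-prime) })
    where
    1-not-prime : ¬ NonTrivial 1
    1-not-prime ()

  -- Cancellation of nonzero power series

  *-cancel-≡ₚ0 : ∀ a b → ¬ a ≡ₚ 0 → a * b ≡ₚ 0 → b ≡ₚ 0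
  *-cancel-≡ₚ0 a b a≢0 ab≡0 with euclidsLemma a b p-prime (≡ₚ0⇒∣ ab≡0)
  ... | inj₁ p∣a = contradiction (∣⇒≡ₚ0 p∣a) a≢0
  ... | inj₂ p∣b = ∣⇒≡ₚ0 p∣b

  +-≡ₚ0ˡ : ∀ {a} b → a ≡ₚ 0 → a + b ≡ₚ b
  +-≡ₚ0ˡ b a≡0 = +-congₚ a≡0 (≡ₚ-refl {b})

  -- Once `g 0` vanishes, `g` is `x` times its tail, so the tail satisfies the same equation with
  -- the index lowered by one.
  unit-cancel : ∀ f g → ¬ f 0 ≡ₚ 0 → f *ps g ≈ₚ 0ps → g ≈ₚ 0ps
  unit-cancel f g f₀≢0 fg≈0 zero    = *-cancel-≡ₚ0 (f 0) (g 0) f₀≢0 (fg≈0 0)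
  unit-cancel f g f₀≢0 fg≈0 (suc m) = unit-cancel f (tail g) f₀≢0
    (λ k → ≡ₚ-trans (≡ₚ-sym (≡ₚ-trans (≡⇒≡ₚ (*ps-sucʳ f g k))
      (+-≡ₚ0ˡ _ (*-≡ₚ0ʳ (f (suc k)) (unit-cancel f g f₀≢0 fg≈0 0))))) (fg≈0 (suc k))) m

  -- Factors `x` are removed from `f` until its constant term is nonzero; the index of a known
  -- nonzero coefficient bounds how often this happens.
  *ps-cancel : ∀ f g → NonZeroPS p f → f *ps g ≈ₚ 0ps → g ≈ₚ 0ps
  *ps-cancel f g (n , fₙ≢0) = cancel n f fₙ≢0
    where
    cancel : ∀ n f → ¬ f n ≡ₚ 0 → f *ps g ≈ₚ 0ps → g ≈ₚ 0ps
    cancel n       f fₙ≢0 fg≈0 with f 0 ≟ₚ0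
    cancel n       f fₙ≢0 fg≈0 | no  f₀≢0 = unit-cancel f g f₀≢0 fg≈0
    cancel zero    f fₙ≢0 fg≈0 | yes f₀≡0 = contradiction f₀≡0 fₙ≢0
    cancel (suc n) f fₙ≢0 fg≈0 | yes f₀≡0 = cancel n (tail f) fₙ≢0
      λ k → ≡ₚ-trans (≡ₚ-sym (≡ₚ-trans (≡⇒≡ₚ (*ps-suc f g k))
        (+-≡ₚ0ˡ _ (*-≡ₚ0ˡ (g (suc k)) f₀≡0)))) (fg≈0 (suc k))

  -- Polynomials among the power series

  Polynomial : PS → Set
  Polynomial g = ∃ λ N → ∀ n → N ≤ n → g n ≡ₚ 0

  -- The degree bound is part of the data, so only finitely many coefficients have to be inspected.
  zero-or-nonzero : ∀ {g} → Polynomial g → g ≈ₚ 0ps ⊎ NonZeroPS p g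
  zero-or-nonzero {g} (N , g≡0) = search N g g≡0
    where
    search : ∀ N g → (∀ n → N ≤ n → g n ≡ₚ 0) → g ≈ₚ 0ps ⊎ NonZeroPS p g
    search zero    g g≡0 = inj₁ λ n → g≡0 n z≤n
    search (suc N) g g≡0 with g 0 ≟ₚ0
    ... | no  g₀≢0 = inj₂ (0 , g₀≢0)
    ... | yes g₀≡0 with search N (tail g) (λ n N≤n → g≡0 (suc n) (s≤s N≤n))
    ...   | inj₁ tail≈0 = inj₁ λ { zero → g₀≡0 ; (suc n) → tail≈0 n }
    ...   | inj₂ (n , gₙ≢0) = inj₂ (suc n , gₙ≢0)

  poly-0 : Polynomial 0ps
  poly-0 = 0 , λ _ _ → ≡ₚ-refl

  poly-1 : Polynomial 1ps
  poly-1 = 1 , λ { (suc n) _ → ≡ₚ-refl }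

  poly-+ : ∀ {f g} → Polynomial f → Polynomial g → Polynomial (f +ps g)
  poly-+ (M , f≡0) (N , g≡0) = M + N , λ n le →
    +-congₚ (f≡0 n (≤-trans (m≤m+n M N) le)) (g≡0 n (≤-trans (m≤n+m N M) le))

  poly-scale : ∀ c {f} → Polynomial f → Polynomial (scale c f)
  poly-scale c (N , f≡0) = N , λ n N≤n → *-≡ₚ0ʳ c (f≡0 n N≤n)

  poly-* : ∀ {f g} → Polynomial f → Polynomial g → Polynomial (f *ps g)
  poly-* {f} {g} (M , f≡0) (N , g≡0) = M + N , bound M f f≡0
    where
    bound : ∀ M f → (∀ n → M ≤ n → f n ≡ₚ 0) → ∀ n → M + N ≤ n → (f *ps g) n ≡ₚ 0
    bound zero    f f≡0 n _ = A.trans {f *ps g} {0ps *ps g} {0ps}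
      (*ps-cong {f} {0ps} {g} {g} (λ n → f≡0 n z≤n) λ _ → ≡ₚ-refl) (A.zeroˡ g) n
    bound (suc M) f f≡0 (suc n) (s≤s le) = ≡ₚ-trans (≡⇒≡ₚ (*ps-suc f g n)) (+-congₚ
      (*-≡ₚ0ʳ (f 0) (g≡0 (suc n) (m≤n⇒m≤1+n (≤-trans (m≤n+m N M) le))))
      (bound M (tail f) (λ n M≤n → f≡0 (suc n) (s≤s M≤n)) n le))

  poly-polyPS : ∀ c → Polynomial (polyPS c)
  poly-polyPS c = List.length c , bound c
    where
    bound : ∀ c n → List.length c ≤ n → polyPS c n ≡ₚ 0
    bound []      n       _        = ≡ₚ-refl
    bound (a ∷ c) (suc n) (s≤s le) = bound c n le

  polyPS-applyUpTo : ∀ N g → (∀ n → N ≤ n → g n ≡ₚ 0) → polyPS (applyUpTo g N) ≈ₚ g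
  polyPS-applyUpTo zero    g g≡0 n       = ≡ₚ-sym (g≡0 n z≤n)
  polyPS-applyUpTo (suc N) g g≡0 zero    = ≡ₚ-refl
  polyPS-applyUpTo (suc N) g g≡0 (suc n) = polyPS-applyUpTo N (tail g) (λ n N≤n → g≡0 (suc n) (s≤s N≤n)) n

  -- Elimination produces scalars as series, whereas `LinIndep` asks for coefficient lists.
  coefficients : ∀ {g} → Polynomial g → Poly
  coefficients {g} (N , _) = applyUpTo g N

  polyPS-coefficients : ∀ {g} (Pg : Polynomial g) → polyPS (coefficients Pg) ≈ₚ g
  polyPS-coefficients {g} (N , g≡0) = polyPS-applyUpTo N g g≡0

  zeroPoly⇒≈0 : ∀ {c} → ZeroPoly p c → polyPS c ≈ₚ 0ps
  zeroPoly⇒≈0 []         n       = ≡ₚ-refl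
  zeroPoly⇒≈0 (a≡0 ∷ c≡0) zero    = a≡0
  zeroPoly⇒≈0 (a≡0 ∷ c≡0) (suc n) = zeroPoly⇒≈0 c≡0 n

  ≈0⇒zeroPoly : ∀ c → polyPS c ≈ₚ 0ps → ZeroPoly p c
  ≈0⇒zeroPoly []      _   = []
  ≈0⇒zeroPoly (a ∷ c) c≈0 = c≈0 0 ∷ ≈0⇒zeroPoly c (c≈0 ∘ suc)

  -- p-th powers of power series

  ×ᴬ-coeff : ∀ m f n → (m ×ᴬ f) n ≡ m * f n
  ×ᴬ-coeff zero    f n = refl
  ×ᴬ-coeff (suc m) f n = cong (f n +_) (×ᴬ-coeff m f n)

  +-^p : ∀ f g → (f +ps g) ^ᴬ p ≈ₚ f ^ᴬ p +ps g ^ᴬ p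
  +-^p = Frobenius.+-^p A.commutativeSemiring p 0<p
    (λ f n → ∣⇒≡ₚ0 (subst (p ∣_) (sym (×ᴬ-coeff p f n)) (m∣m*n (f n))))
    (λ k 0<k k<p → subst (λ q → p ∣ q C k) (*-identityʳ p)
      (p∣[p^m]Ck p-prime 1 k 0<k (subst (k <_) (sym (*-identityʳ p)) k<p)))

  X : PS
  X zero    = 0
  X (suc n) = 1ps n

  X*-suc : ∀ g n → (X *ps g) (suc n) ≡ g n
  X*-suc g n = trans (*ps-suc X g n) (*ps-identityˡ-≗ g n)

  X^*-< : ∀ k g n → n < k → (X ^ᴬ k *ps g) n ≡ₚ 0
  X^*-< (suc k) g zero    _        = ≡ₚ-refl
  X^*-< (suc k) g (suc n) (s≤s n<k) = ≡ₚ-trans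
    (≡⇒≡ₚ (trans (*ps-assoc-≗ X (X ^ᴬ k) g (suc n)) (X*-suc (X ^ᴬ k *ps g) n)))
    (X^*-< k g n n<k)

  X^*-+ : ∀ k g n → (X ^ᴬ k *ps g) (k + n) ≡ g n
  X^*-+ zero    g n = *ps-identityˡ-≗ g n
  X^*-+ (suc k) g n = trans (*ps-assoc-≗ X (X ^ᴬ k) g (suc (k + n)))
    (trans (X*-suc (X ^ᴬ k *ps g) (k + n)) (X^*-+ k g n))

  const : ℕ → PS
  const a = scale a 1ps

  -- Fermat's little theorem, from additivity of the p-th power applied to `1ps +ps const a`.
  const-^p : ∀ a → const a ^ᴬ p ≈ₚ const a
  const-^p zero = helper p 0<p
    where
    helper : ∀ q → 0 < q → const 0 ^ᴬ q ≈ₚ const 0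
    helper (suc r) _ = A.zeroˡ (const 0 ^ᴬ r)
  const-^p (suc a) = begin
    (1ps +ps const a) ^ᴬ p      ≈⟨ +-^p 1ps (const a) ⟩
    1ps ^ᴬ p +ps const a ^ᴬ p   ≈⟨ A.+-cong {1ps ^ᴬ p} {1ps} {const a ^ᴬ p} {const a} (1^ p) (const-^p a) ⟩
    1ps +ps const a             ∎
    where
    open import Relation.Binary.Reasoning.Setoid A.setoid
    1^ : ∀ k → 1ps ^ᴬ k ≈ₚ 1ps
    1^ zero    = A.refl {1ps}
    1^ (suc k) = A.trans {1ps ^ᴬ suc k} {1ps ^ᴬ k} {1ps} (A.*-identityˡ (1ps ^ᴬ k)) (1^ k)

  head-tail : ∀ h → h ≈ₚ const (h 0) +ps (X *ps tail h)
  head-tail h zero    = ≡⇒≡ₚ (sym (trans (+-identityʳ _) (*-identityʳ (h 0))))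
  head-tail h (suc n) = ≡⇒≡ₚ (sym (cong₂ _+_ (*-zeroʳ (h 0)) (X*-suc (tail h) n)))

  -- One step of h(x)^p = h(x^p), in the form of a recursion along the coefficients of `h`.
  ^p-head-tail : ∀ h → h ^ᴬ p ≈ₚ const (h 0) +ps (X ^ᴬ p *ps tail h ^ᴬ p)
  ^p-head-tail h = begin
    h ^ᴬ p
      ≈⟨ ^-congˡ p {h} (head-tail h) ⟩
    (const (h 0) +ps (X *ps tail h)) ^ᴬ p
      ≈⟨ +-^p (const (h 0)) (X *ps tail h) ⟩
    const (h 0) ^ᴬ p +ps (X *ps tail h) ^ᴬ p
      ≈⟨ A.+-cong {const (h 0) ^ᴬ p} {const (h 0)} {(X *ps tail h) ^ᴬ p}
           (const-^p (h 0)) (^-distrib-* X (tail h) p) ⟩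
    const (h 0) +ps (X ^ᴬ p *ps tail h ^ᴬ p) ∎
    where open import Relation.Binary.Reasoning.Setoid A.setoid

  -- The component of g at the basis element xʲ of 𝔽_p((x)) over 𝔽_p((xᵖ)).
  section : ℕ → PS → PS
  section j g t = g (j + p * t)

  *^p-head-tail : ∀ c h → c *ps h ^ᴬ p ≈ₚ scale (h 0) c +ps (X ^ᴬ p *ps (c *ps tail h ^ᴬ p))
  *^p-head-tail c h = begin
    c *ps h ^ᴬ p
      ≈⟨ A.*-congˡ {c} {h ^ᴬ p} (^p-head-tail h) ⟩
    c *ps (const (h 0) +ps (X ^ᴬ p *ps tail h ^ᴬ p))
      ≈⟨ A.distribˡ c (const (h 0)) (X ^ᴬ p *ps tail h ^ᴬ p) ⟩
    (c *ps const (h 0)) +ps (c *ps (X ^ᴬ p *ps tail h ^ᴬ p))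
      ≈⟨ A.+-cong {c *ps const (h 0)} {scale (h 0) c} {c *ps (X ^ᴬ p *ps tail h ^ᴬ p)} constant shifted ⟩
    scale (h 0) c +ps (X ^ᴬ p *ps (c *ps tail h ^ᴬ p)) ∎
    where
    open import Relation.Binary.Reasoning.Setoid A.setoid
    constant : c *ps const (h 0) ≈ₚ scale (h 0) c
    constant n = ≡⇒≡ₚ (trans (*ps-comm-≗ c (const (h 0)) n)
      (trans (scale-*ps (h 0) 1ps c n) (cong (h 0 *_) (*ps-identityˡ-≗ c n))))
    shifted : c *ps (X ^ᴬ p *ps tail h ^ᴬ p) ≈ₚ X ^ᴬ p *ps (c *ps tail h ^ᴬ p)
    shifted = begin
      c *ps (X ^ᴬ p *ps tail h ^ᴬ p)   ≈⟨ A.*-assoc c (X ^ᴬ p) (tail h ^ᴬ p) ⟨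
      (c *ps X ^ᴬ p) *ps tail h ^ᴬ p   ≈⟨ A.*-congʳ {tail h ^ᴬ p} {c *ps X ^ᴬ p} (A.*-comm c (X ^ᴬ p)) ⟩
      (X ^ᴬ p *ps c) *ps tail h ^ᴬ p   ≈⟨ A.*-assoc (X ^ᴬ p) c (tail h ^ᴬ p) ⟩
      X ^ᴬ p *ps (c *ps tail h ^ᴬ p)   ∎

  -- Since h(x)^p = h(x^p), multiplication by it keeps each residue class of exponents modulo `p`
  -- and acts there as multiplication by `h`. Each coefficient split off from `h` leaves a factor
  -- `X ^ᴬ p`, which shifts a section by one place.
  section-*^p : ∀ j → j < p → ∀ c h → section j (c *ps h ^ᴬ p) ≈ₚ section j c *ps h
  section-*^p j j<p c h zero = begin
    (c *ps h ^ᴬ p) j₀                                       ≈⟨ *^p-head-tail c h j₀ ⟩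
    h 0 * c j₀ + (X ^ᴬ p *ps (c *ps tail h ^ᴬ p)) j₀        ≈⟨ +-congₚ {h 0 * c j₀} ≡ₚ-refl
      -- Because `j < p`, the multiple of `X ^ᴬ p` does not reach degree `j`.
      (X^*-< p (c *ps tail h ^ᴬ p) j₀ (subst (_< p) (sym j₀≡j) j<p)) ⟩
    h 0 * c j₀ + 0                                          ≡⟨ trans (+-identityʳ _) (*-comm (h 0) (c j₀)) ⟩
    c j₀ * h 0                                              ∎
    where
    open import Relation.Binary.Reasoning.Setoid ≡ₚ-setoid
    j₀ = j + p * 0
    j₀≡j : j₀ ≡ j
    j₀≡j = trans (cong (j +_) (*-zeroʳ p)) (+-identityʳ j)
  section-*^p j j<p c h (suc t) = begin
    (c *ps h ^ᴬ p) (j + p * suc t)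
      ≈⟨ *^p-head-tail c h (j + p * suc t) ⟩
    h 0 * c (j + p * suc t) + (X ^ᴬ p *ps (c *ps tail h ^ᴬ p)) (j + p * suc t)
      ≡⟨ cong₂ _+_ (*-comm (h 0) (c (j + p * suc t))) (trans
           (cong (X ^ᴬ p *ps (c *ps tail h ^ᴬ p)) (rearrange j p t))
           (X^*-+ p (c *ps tail h ^ᴬ p) (j + p * t))) ⟩
    c (j + p * suc t) * h 0 + (c *ps tail h ^ᴬ p) (j + p * t)
      ≈⟨ +-congₚ {c (j + p * suc t) * h 0} ≡ₚ-refl (section-*^p j j<p c (tail h) t) ⟩
    section j c (suc t) * h 0 + (section j c *ps tail h) t
      ≡⟨ *ps-sucʳ (section j c) h t ⟨
    (section j c *ps h) (suc t) ∎
    where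
    open import Relation.Binary.Reasoning.Setoid ≡ₚ-setoid
    rearrange : ∀ j p t → j + p * suc t ≡ p + (j + p * t)
    rearrange = solve-∀

  section-split : ∀ n → n ≡ n % p + p * (n / p)
  section-split n = trans (m≡m%n+[m/n]*n n p) (cong (n % p +_) (*-comm (n / p) p))

  sections≈0⇒≈0 : ∀ g → (∀ j → j < p → section j g ≈ₚ 0ps) → g ≈ₚ 0ps
  sections≈0⇒≈0 g sections≈0 n = subst (λ n → g n ≡ₚ 0) (sym (section-split n))
    (sections≈0 (n % p) (m%n<n n p) (n / p))

  poly-section : ∀ j {g} → Polynomial g → Polynomial (section j g)
  poly-section j (N , g≡0) = N , λ n N≤n →
    g≡0 (j + p * n) (≤-trans N≤n (≤-trans (m≤n*m n p) (m≤n+m (p * n) j)))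

  section-1 : ∀ j → 0 < j → section j 1ps ≈ₚ 0ps
  section-1 (suc j) _ t = ≡ₚ-refl

  section-0-1 : section 0 1ps ≈ₚ 1ps
  section-0-1 zero    = ≡⇒≡ₚ (cong 1ps (*-zeroʳ p))
  section-0-1 (suc t) = helper p 0<p
    where
    helper : ∀ q → 0 < q → 1ps (q * suc t) ≡ₚ 0
    helper (suc r) _ = ≡ₚ-refl

  -- Writing `g ^ᴬ p` as `1ps *ps g ^ᴬ p` makes its sections multiples of those of `1ps`: the
  -- section at 0 is `g` and the others vanish.
  ^p-supported : ∀ d g → (∀ n → ¬ d ∣ n → g n ≡ₚ 0) → ∀ n → ¬ (p * d ∣ n) → (g ^ᴬ p) n ≡ₚ 0
  ^p-supported d g supported n pd∤n = begin
    (g ^ᴬ p) n                      ≡⟨ *ps-identityˡ-≗ (g ^ᴬ p) n ⟨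
    (1ps *ps g ^ᴬ p) n              ≡⟨ cong (1ps *ps g ^ᴬ p) (section-split n) ⟩
    section (n % p) (1ps *ps g ^ᴬ p) (n / p)
                                    ≈⟨ section-*^p (n % p) (m%n<n n p) 1ps g (n / p) ⟩
    (section (n % p) 1ps *ps g) (n / p) ≈⟨ cases (n % p) refl ⟩
    0                               ∎
    where
    open import Relation.Binary.Reasoning.Setoid ≡ₚ-setoid
    cases : ∀ j → n % p ≡ j → (section j 1ps *ps g) (n / p) ≡ₚ 0
    cases zero n%p≡0 = ≡ₚ-trans
      (*ps-cong {section 0 1ps} {1ps} {g} section-0-1 (λ _ → ≡ₚ-refl) (n / p))
      (≡ₚ-trans (≡⇒≡ₚ (*ps-identityˡ-≗ g (n / p))) (supported (n / p) λ d∣n/p →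
        pd∤n (subst (p * d ∣_) (sym (trans (section-split n) (cong (_+ p * (n / p)) n%p≡0)))
          (*-monoʳ-∣ p d∣n/p))))
    cases (suc j) _ = A.trans {section (suc j) 1ps *ps g} {0ps *ps g} {0ps}
      (*ps-cong {section (suc j) 1ps} {0ps} {g} (section-1 (suc j) z<s) (λ _ → ≡ₚ-refl)) (A.zeroˡ g) (n / p)

  iterate-^p : ∀ h m → (h ^ᴬ (p ^ m)) ^ᴬ p ≈ₚ h ^ᴬ (p ^ suc m)
  iterate-^p h m = subst (λ k → (h ^ᴬ (p ^ m)) ^ᴬ p ≈ₚ h ^ᴬ k) (*-comm (p ^ m) p) (^-assocʳ h (p ^ m) p)

  ^p^m-supported : ∀ m h n → ¬ (p ^ m ∣ n) → (h ^ᴬ (p ^ m)) n ≡ₚ 0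
  ^p^m-supported zero    h n 1∤n = contradiction (1∣ n) 1∤n
  ^p^m-supported (suc m) h n q∤n = ≡ₚ-trans
    (A.sym {(h ^ᴬ (p ^ m)) ^ᴬ p} {h ^ᴬ (p ^ suc m)} (iterate-^p h m) n)
    (^p-supported (p ^ m) (h ^ᴬ (p ^ m)) (^p^m-supported m h) n q∤n)

  -- Linearity of Hasse derivatives over series in x^(p^m)

  sumTo-congₚ : ∀ n {F G : ℕ → ℕ} → (∀ i → i ≤ n → F i ≡ₚ G i) → sumTo n F ≡ₚ sumTo n G
  sumTo-congₚ zero    F≡G = F≡G 0 z≤n
  sumTo-congₚ (suc n) F≡G = +-congₚ (sumTo-congₚ n λ i i≤n → F≡G i (m≤n⇒m≤1+n i≤n)) (F≡G (suc n) ≤-refl)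

  sumTo-distribˡ : ∀ c n F → c * sumTo n F ≡ sumTo n (λ i → c * F i)
  sumTo-distribˡ c zero    F = refl
  sumTo-distribˡ c (suc n) F = trans (*-distribˡ-+ c (sumTo n F) (F (suc n)))
    (cong (_+ c * F (suc n)) (sumTo-distribˡ c n F))

  sumTo-drop : ∀ k n F → (∀ i → i < k → F i ≡ₚ 0) → sumTo (n + k) F ≡ₚ sumTo n (λ i → F (i + k))
  sumTo-drop zero    zero    F F≡0 = ≡ₚ-refl
  sumTo-drop (suc k) zero    F F≡0 = +-≡ₚ0ˡ (F (suc k))
    (≡ₚ-trans (sumTo-drop k 0 F λ i i<k → F≡0 i (m<n⇒m<1+n i<k)) (F≡0 k ≤-refl))
  sumTo-drop k       (suc n) F F≡0 = +-congₚ (sumTo-drop k n F F≡0) (≡ₚ-refl {F (suc n + k)})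

  -- Only those `i` contribute for which `n + k ∸ i` is a multiple of `p ^ m`. There `(n + k) C k`
  -- and `i C k` agree modulo `p`, so the binomial weight attaches to `g` alone. Terms with `i < k`
  -- drop out because `i C k` is 0.
  hasse-*-supported : ∀ m k → k < p ^ m → ∀ g u → (∀ n → ¬ (p ^ m ∣ n) → u n ≡ₚ 0) →
    hasse k (g *ps u) ≈ₚ hasse k g *ps u
  hasse-*-supported m k k<q g u supported n = begin
    ((n + k) C k) * sumTo (n + k) (λ i → g i * u (n + k ∸ i))
      ≡⟨ sumTo-distribˡ ((n + k) C k) (n + k) (λ i → g i * u (n + k ∸ i)) ⟩
    sumTo (n + k) (λ i → ((n + k) C k) * (g i * u (n + k ∸ i)))
      ≈⟨ sumTo-congₚ (n + k) termwise ⟩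
    sumTo (n + k) F
      ≈⟨ sumTo-drop k n F (λ i i<k → *-≡ₚ0ˡ (u (n + k ∸ i))
           (*-≡ₚ0ˡ (g i) (≡⇒≡ₚ (k>n⇒nCk≡0 {i} {k} i<k)))) ⟩
    sumTo n (λ i → F (i + k))
      ≈⟨ sumTo-congₚ n (λ i _ → ≡⇒≡ₚ (cong (λ d → ((i + k) C k) * g (i + k) * u d) (cancel i))) ⟩
    (hasse k g *ps u) n ∎
    where
    open import Relation.Binary.Reasoning.Setoid ≡ₚ-setoid
    F : ℕ → ℕ
    F i = (i C k) * g i * u (n + k ∸ i)

    cancel : ∀ i → n + k ∸ (i + k) ≡ n ∸ i
    cancel i = trans (cong₂ _∸_ (+-comm n k) (+-comm i k)) ([m+n]∸[m+o]≡n∸o k n i)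

    termwise : ∀ i → i ≤ n + k → ((n + k) C k) * (g i * u (n + k ∸ i)) ≡ₚ F i
    termwise i i≤n+k with p ^ m ∣? (n + k ∸ i)
    ... | no q∤ = ≡ₚ-trans
      (*-≡ₚ0ʳ ((n + k) C k) (*-≡ₚ0ʳ (g i) (supported (n + k ∸ i) q∤)))
      (≡ₚ-sym (*-≡ₚ0ʳ ((i C k) * g i) (supported (n + k ∸ i) q∤)))
    ... | yes (divides s eq) = ≡ₚ-trans
      (*-congₚ binomials (≡ₚ-refl {g i * u (n + k ∸ i)}))
      (≡⇒≡ₚ (sym (*-assoc (i C k) (g i) (u (n + k ∸ i)))))
      where
      binomials : ((n + k) C k) ≡ₚ (i C k)
      binomials = subst (λ a → (a C k) ≡ₚ (i C k))
        (trans (cong (i +_) (sym eq)) (m+[n∸m]≡n i≤n+k)) ([a+sp^m]Ck p-prime m s i k k<q)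

-- The extension generated by f

module Extension (p : ℕ) (p-prime : Prime p) where

  open PrimePS p p-prime

  1≉0 : ¬ 1ps ≈ₚ 0ps
  1≉0 1≈0 = 1≢ₚ0 (1≈0 0)

  polynomial-≟0 : ∀ {g} → Polynomial g → Dec (g ≈ₚ 0ps)
  polynomial-≟0 Pg with zero-or-nonzero Pg
  ... | inj₁ g≈0        = yes g≈0
  ... | inj₂ (n , gₙ≢0) = no λ g≈0 → gₙ≢0 (g≈0 n)

  polynomial-cancel : ∀ {f g} → Polynomial f → ¬ f ≈ₚ 0ps → f *ps g ≈ₚ 0ps → g ≈ₚ 0ps
  polynomial-cancel {f} {g} Pf f≉0 with zero-or-nonzero Pf
  ... | inj₁ f≈0 = contradiction f≈0 f≉0
  ... | inj₂ f≢0 = *ps-cancel f g f≢0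

  open Subring.Spans psRing Polynomial poly-0 poly-1 poly-+ poly-* (poly-scale (pred p))
    polynomial-≟0 1≉0 polynomial-cancel

  open import Relation.Binary.Reasoning.Setoid A.setoid

  poly-^ : ∀ k {g} → Polynomial g → Polynomial (g ^ᴬ k)
  poly-^ zero    Pg = poly-1
  poly-^ (suc k) {g} Pg = poly-* {g} {g ^ᴬ k} Pg (poly-^ k Pg)

  scalar-^ : Scalar → ℕ → Scalar
  scalar-^ (c , Pc) k = c ^ᴬ k , poly-^ k Pc

  scalar-^-≉0 : ∀ c k → ¬ ι c ≈ₚ 0ps → ¬ ι (scalar-^ c k) ≈ₚ 0ps
  scalar-^-≉0 c zero    c≉0 = 1≉0
  scalar-^-≉0 c (suc k) c≉0 = *-≉0 c (scalar-^ c k) c≉0 (scalar-^-≉0 c k c≉0)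

  section-comb : ∀ j → j < p → ∀ {n} (v : Fin n → Scalar) (b : Fin n → PS) →
    section j (comb v (λ i → b i ^ᴬ p)) ≈ₚ comb (λ i → section j (ι (v i)) , poly-section j (proj₂ (v i))) b
  section-comb j j<p {zero}  v b t = ≡ₚ-refl
  section-comb j j<p {suc n} v b t = +-congₚ
    (section-*^p j j<p (ι (v zero)) (b zero) t)
    (section-comb j j<p (V.tail v) (V.tail b) t)

  independent-^p : ∀ {n} {b : Fin n → PS} → Independent b → Independent (λ i → b i ^ᴬ p)
  independent-^p {b = b} indep v comb≈0 i = sections≈0⇒≈0 (ι (v i)) λ j j<p →
    indep (λ i → section j (ι (v i)) , poly-section j (proj₂ (v i)))
      (λ t → ≡ₚ-trans (≡ₚ-sym (section-comb j j<p v b t)) (comb≈0 (j + p * t))) i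

  independent-cong : ∀ {n} {b b′ : Fin n → PS} → (∀ i → b i ≈ₚ b′ i) → Independent b → Independent b′
  independent-cong {b = b} {b′} b≈b′ indep v comb≈0 = indep v
    (A.trans {comb v b} {comb v b′} {0ps} (comb-cong v {b} {b′} b≈b′) comb≈0)

  -- The splitting is carried out along p-th powers and iterated `m` times, so sections modulo `p`
  -- suffice.
  independent-^p^m : ∀ m {n} {b : Fin n → PS} → Independent b → Independent (λ i → b i ^ᴬ (p ^ m))
  independent-^p^m zero    {b = b} = independent-cong λ i →
    A.sym {b i ^ᴬ 1} {b i} (A.*-identityʳ (b i))
  independent-^p^m (suc m) {b = b} indep = independent-cong (λ i → iterate-^p (b i) m)
    (independent-^p (independent-^p^m m indep))

  hasse-cong : ∀ k {f g} → f ≈ₚ g → hasse k f ≈ₚ hasse k g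
  hasse-cong k f≈g n = *-congₚ (≡ₚ-refl {(n + k) C k}) (f≈g (n + k))

  poly-hasse : ∀ k {g} → Polynomial g → Polynomial (hasse k g)
  poly-hasse k (N , g≡0) = N , λ n N≤n → *-≡ₚ0ʳ ((n + k) C k) (g≡0 (n + k) (≤-trans N≤n (m≤m+n n k)))

  scalar-hasse : ℕ → Scalar → Scalar
  scalar-hasse k (c , Pc) = hasse k c , poly-hasse k Pc

  hasse-comb : ∀ m k → k < p ^ m → ∀ {n} (v : Fin n → Scalar) (b : Fin n → PS) →
    hasse k (comb v (λ i → b i ^ᴬ (p ^ m))) ≈ₚ comb (scalar-hasse k ∘ v) (λ i → b i ^ᴬ (p ^ m))
  hasse-comb m k k<q {zero}  v b n = ≡⇒≡ₚ (*-zeroʳ ((n + k) C k))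
  hasse-comb m k k<q {suc _} v b n = ≡ₚ-trans
    (≡⇒≡ₚ (*-distribˡ-+ ((n + k) C k) ((ι (v zero) *ps b zero ^ᴬ (p ^ m)) (n + k)) _))
    (+-congₚ
      (hasse-*-supported m k k<q (ι (v zero)) (b zero ^ᴬ (p ^ m)) (^p^m-supported m (b zero)) n)
      (hasse-comb m k k<q (V.tail v) (V.tail b) n))

  -- Allows `q = p ^ k` to be used for the derivative of order `k`.
  k<p^k : ∀ k → k < p ^ k
  k<p^k zero    = z<s
  k<p^k (suc k) = <-≤-trans (s<s (k<p^k k)) (≤-trans (+-monoˡ-≤ (p ^ k) (m^n>0 p k))
    (≤-trans (≤-reflexive (cong (p ^ k +_) (sym (+-identityʳ (p ^ k)))))
      (*-monoˡ-≤ (p ^ k) (nonTrivial⇒n>1 p {{prime⇒nonTrivial p-prime}}))))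

  module Algebraic (f : PS) (n : ℕ)
    (independent : Independent (powers {n} f)) (f^n∈ : Span (powers {n} f) (f ^ᴬ n)) where

    open PowerSpan f n f^n∈

    f∈V : V f
    f∈V = Span-cong {b = powers f} {1ps *ps f} {f} (A.*-identityˡ f) (V-*f {1ps} V-1)

    -- K(f) = K(f^q) for K = 𝔽_p(x), and ∂_k is linear over q-th powers when k < q.
    hasse∈V : ∀ k → V (hasse k f)
    hasse∈V k = Span-unscale {b = powers f} (scalar-^ c q) {hasse k f} (scalar-^-≉0 c q c≉0)
      (Span-cong {b = powers f} {comb (scalar-hasse k ∘ w) b′} {ι c ^ᴬ q *ps hasse k f}
        (begin
          comb (scalar-hasse k ∘ w) b′ ≈⟨ hasse-comb k k (k<p^k k) w (powers f) ⟨
          hasse k (comb w b′)          ≈⟨ hasse-cong k {f *ps ι c ^ᴬ q} {comb w b′} c^q*f ⟨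
          hasse k (f *ps ι c ^ᴬ q)     ≈⟨ hasse-*-supported k k (k<p^k k) f (ι c ^ᴬ q) (^p^m-supported k (ι c)) ⟩
          hasse k f *ps ι c ^ᴬ q       ≈⟨ A.*-comm (hasse k f) (ι c ^ᴬ q) ⟩
          ι c ^ᴬ q *ps hasse k f       ∎)
        (Span-comb {b = powers f} (scalar-hasse k ∘ w) b′ b′∈V))
      where
      q = p ^ k

      b′ : Fin n → PS
      b′ i = powers f i ^ᴬ q

      b′∈V : ∀ i → V (b′ i)
      b′∈V i = V-power q {powers f i} (Span-basis {b = powers f} i)

      f∈ : Span b′ f
      f∈ = Span-exchange (powers f) b′ (independent-^p^m k independent) b′∈V {f} f∈V

      c : Scalar
      c = proj₁ f∈

      c≉0 = proj₁ (proj₂ f∈)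

      v w : Fin n → Scalar
      v = proj₁ (proj₂ (proj₂ f∈))
      -- The extra factor turns the denominator `c` of `f` into its q-th power, which passes through
      -- the Hasse derivative like a constant.
      w i = scalar-^ c (pred q) D.* v i

      c^q*f : f *ps ι c ^ᴬ q ≈ₚ comb w b′
      c^q*f = begin
        f *ps ι c ^ᴬ q                    ≡⟨ cong (λ q → f *ps ι c ^ᴬ q) (suc-pred q {{m^n≢0 p k}}) ⟨
        f *ps (ι c *ps ι c ^ᴬ pred q)     ≈⟨ A.*-assoc f (ι c) (ι c ^ᴬ pred q) ⟨
        (f *ps ι c) *ps ι c ^ᴬ pred q     ≈⟨ A.*-comm (f *ps ι c) (ι c ^ᴬ pred q) ⟩
        ι c ^ᴬ pred q *ps (f *ps ι c)     ≈⟨ A.*-congˡ {ι c ^ᴬ pred q} {f *ps ι c} {ι c *ps f} (A.*-comm f (ι c)) ⟩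
        ι c ^ᴬ pred q *ps (ι c *ps f)     ≈⟨ A.*-congˡ {ι c ^ᴬ pred q} {ι c *ps f} {comb v b′} (proj₂ (proj₂ (proj₂ f∈))) ⟩
        ι c ^ᴬ pred q *ps comb v b′       ≈⟨ comb-* (scalar-^ c (pred q)) v b′ ⟨
        comb w b′                         ∎

    module _ (α : ℕ → PS) (dlog : ∀ k → 1 ≤ k → hasse k f ≈ₚ α k *ps f) where

      α∈ : ∀ i → V[1/f] (α (suc i))
      α∈ i = 1 , Span-cong {b = powers f} {hasse (suc i) f} {f ^ᴬ 1 *ps α (suc i)}
        (begin
          hasse (suc i) f       ≈⟨ dlog (suc i) (s≤s z≤n) ⟩
          α (suc i) *ps f       ≈⟨ A.*-comm (α (suc i)) f ⟩
          f *ps α (suc i)       ≈⟨ A.*-congʳ {α (suc i)} {f ^ᴬ 1} {f} (A.*-identityʳ f) ⟨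
          f ^ᴬ 1 *ps α (suc i)  ∎)
        (hasse∈V (suc i))

      monoPS∈ : ∀ is → V[1/f] (monoPS α is)
      monoPS∈ []       = V⇒V[1/f] {1ps} V-1
      monoPS∈ (i ∷ is) = V[1/f]-* {α (suc i)} {monoPS α is} (α∈ i) (monoPS∈ is)

      evalElem∈ : ∀ e → V[1/f] (evalElem α e)
      evalElem∈ []             = V⇒V[1/f] {0ps} (Span-0 {b = powers f})
      evalElem∈ ((c , is) ∷ e) = V[1/f]-+ {polyPS c *ps monoPS α is} {evalElem α e}
        (V[1/f]-* {polyPS c} {monoPS α is}
          (V⇒V[1/f] {polyPS c} (Span-cong {b = powers f} {polyPS c *ps 1ps} {polyPS c} (A.*-identityʳ (polyPS c))
            (Span-scale {b = powers f} (polyPS c , poly-polyPS c) {1ps} V-1)))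
          (monoPS∈ is))
        (evalElem∈ e)

      ^-cancel : NonZeroPS p f → ∀ k g → f ^ᴬ k *ps g ≈ₚ 0ps → g ≈ₚ 0ps
      ^-cancel f≢0 zero    g 1g≈0  = A.trans {g} {1ps *ps g} {0ps}
        (A.sym {1ps *ps g} {g} (A.*-identityˡ g)) 1g≈0
      ^-cancel f≢0 (suc k) g ffg≈0 = ^-cancel f≢0 k g (*ps-cancel f (f ^ᴬ k *ps g) f≢0
        (A.trans {f *ps (f ^ᴬ k *ps g)} {f ^ᴬ suc k *ps g} {0ps}
          (A.sym {f ^ᴬ suc k *ps g} {f *ps (f ^ᴬ k *ps g)} (A.*-assoc f (f ^ᴬ k) g)) ffg≈0))

      coefficientVec : ∀ {N} → (Fin N → Scalar) → Vec Poly N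
      coefficientVec a = Vec.tabulate (λ j → coefficients (proj₂ (a j)))

      combination : ∀ {N} (a : Fin N → Scalar) (es : Vec Elem N) →
        foldr′ _+ps_ 0ps (zipWith (λ c e → polyPS c *ps evalElem α e) (coefficientVec a) es)
          ≈ₚ comb a (λ j → evalElem α (Vec.lookup es j))
      combination a Vec.[]       m = ≡ₚ-refl
      combination a (e Vec.∷ es) m = +-congₚ
        (*ps-cong {polyPS (coefficients (proj₂ (a zero)))} {ι (a zero)} {evalElem α e}
          (polyPS-coefficients (proj₂ (a zero))) (λ _ → ≡ₚ-refl) m)
        (combination (V.tail a) es m)

      not-infinite : NonZeroPS p f → ¬ InfiniteExt p α
      not-infinite f≢0 infinite =
        let es , es-indep    = infinite (suc n)
            g                = λ j → evalElem α (Vec.lookup es j)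
            k , f^k*g∈       = common-exponent g (λ j → evalElem∈ (Vec.lookup es j))
            a , (j , aj≉0) , dep = Span-dependent {b = powers f} (λ j → f ^ᴬ k *ps g j) f^k*g∈
            -- The relation found holds between the multiples `f ^ᴬ k *ps g j`; as `f` is nonzero,
            -- the power is cancelled to reach the `g j` themselves.
            comb≈0 = ^-cancel f≢0 k (comb a g) (begin
              f ^ᴬ k *ps comb a g            ≈⟨ A.*-comm (f ^ᴬ k) (comb a g) ⟩
              comb a g *ps f ^ᴬ k            ≈⟨ comb-*ʳ a g (f ^ᴬ k) ⟨
              comb a (λ j → g j *ps f ^ᴬ k)  ≈⟨ comb-cong a {λ j → g j *ps f ^ᴬ k} {λ j → f ^ᴬ k *ps g j}
                                                  (λ j → A.*-comm (g j) (f ^ᴬ k)) ⟩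
              comb a (λ j → f ^ᴬ k *ps g j)  ≈⟨ dep ⟩
              0ps                            ∎)
            zero-coefficients = es-indep (coefficientVec a) (λ m → ≡ₚ-trans (combination a es m) (comb≈0 m))
        in aj≉0 (λ m → ≡ₚ-trans
             (≡ₚ-sym (polyPS-coefficients (proj₂ (a j)) m))
             (zeroPoly⇒≈0 {coefficients (proj₂ (a j))} (VecAll.tabulate⁻ {f = coefficients ∘ proj₂ ∘ a} zero-coefficients j) m))

  -- Independence of the powers of f

  comb-powers-last : ∀ n f (v : Fin (suc n) → Scalar) →
    comb v (powers f) ≈ₚ comb (v ∘ inject₁) (powers f) +ps (ι (v (fromℕ n)) *ps f ^ᴬ n)
  comb-powers-last n f v = begin
    comb v (powers f)
      ≈⟨ sum-init-last (λ i → ι (v i) *ps powers f i) ⟩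
    comb (v ∘ inject₁) (λ i → f ^ᴬ toℕ (inject₁ i)) +ps (ι (v (fromℕ n)) *ps f ^ᴬ toℕ (fromℕ n))
      ≈⟨ A.+-cong {comb (v ∘ inject₁) (λ i → f ^ᴬ toℕ (inject₁ i))} {comb (v ∘ inject₁) (powers f)}
           {ι (v (fromℕ n)) *ps f ^ᴬ toℕ (fromℕ n)} {ι (v (fromℕ n)) *ps f ^ᴬ n}
           (comb-cong (v ∘ inject₁) {λ i → f ^ᴬ toℕ (inject₁ i)} {powers f} λ i →
             A.reflexive (cong (f ^ᴬ_) (toℕ-inject₁ i)))
           (A.reflexive (cong (λ k → ι (v (fromℕ n)) *ps f ^ᴬ k) (toℕ-fromℕ n))) ⟩
    comb (v ∘ inject₁) (powers f) +ps (ι (v (fromℕ n)) *ps f ^ᴬ n) ∎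
    where open import Algebra.Properties.Semiring.Sum A.semiring using (sum-init-last)

  -- Induction on `n` replaces the choice of a minimal polynomial. A nonzero leading coefficient
  -- would put `f ^ᴬ n` into the span of the lower powers, which are already independent, and
  -- `Algebraic` would contradict infinitude. A zero one leaves a shorter relation.
  powers-independent : ∀ f α → NonZeroPS p f → (∀ k → 1 ≤ k → hasse k f ≈ₚ α k *ps f) →
    InfiniteExt p α → ∀ n → Independent (powers {n} f)
  powers-independent f α f≢0 dlog infinite zero    v comb≈0 ()
  powers-independent f α f≢0 dlog infinite (suc n) v comb≈0 with polynomial-≟0 (proj₂ (v (fromℕ n)))
  ... | no top≉0 = ⊥-elim (Algebraic.not-infinite f n indep f^n∈ α dlog f≢0 infinite)
    where
    indep = powers-independent f α f≢0 dlog infinite n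
    top = ι (v (fromℕ n))
    lower = comb (v ∘ inject₁) (powers f)
    open import Algebra.Properties.Group A.+-group using (inverseʳ-unique)
    open import Algebra.Properties.Ring A.ring using (-1*x≈-x)
    f^n∈ : Span (powers {n} f) (f ^ᴬ n)
    f^n∈ = v (fromℕ n) , top≉0 , (λ i → D.- D.1# D.* v (inject₁ i)) , (begin
      top *ps f ^ᴬ n                ≈⟨ inverseʳ-unique lower (top *ps f ^ᴬ n)
                                        (A.trans {lower +ps (top *ps f ^ᴬ n)} {comb v (powers f)} {0ps}
                                          (A.sym {comb v (powers f)} (comb-powers-last n f v)) comb≈0) ⟩
      negps lower                   ≈⟨ -1*x≈-x lower ⟨
      negps 1ps *ps lower           ≈⟨ comb-* (D.- D.1#) (v ∘ inject₁) (powers f) ⟨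
      comb (λ i → D.- D.1# D.* v (inject₁ i)) (powers f) ∎)
  ... | yes top≈0 = all-zero
    where
    indep = powers-independent f α f≢0 dlog infinite n
    top = ι (v (fromℕ n))
    lower = comb (v ∘ inject₁) (powers f)
    lower≈0 : lower ≈ₚ 0ps
    lower≈0 = begin
      lower                          ≈⟨ A.+-identityʳ lower ⟨
      lower +ps 0ps                  ≈⟨ A.+-congˡ {lower} {0ps} {0ps *ps f ^ᴬ n} (A.sym {0ps *ps f ^ᴬ n} {0ps} (A.zeroˡ (f ^ᴬ n))) ⟩
      lower +ps (0ps *ps f ^ᴬ n)     ≈⟨ A.+-congˡ {lower} {0ps *ps f ^ᴬ n} {top *ps f ^ᴬ n}
                                         (A.*-congʳ {f ^ᴬ n} {0ps} {top} (A.sym {top} {0ps} top≈0)) ⟩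
      lower +ps (top *ps f ^ᴬ n)     ≈⟨ comb-powers-last n f v ⟨
      comb v (powers f)              ≈⟨ comb≈0 ⟩
      0ps                            ∎
    all-zero : ∀ i → ι (v i) ≈ₚ 0ps
    all-zero i with view i
    ... | ‵fromℕ     = top≈0
    ... | ‵inject₁ j = indep (v ∘ inject₁) lower≈0 j

  -- Polynomial relations as linear relations between powers

  ^ps≡^ᴬ : ∀ f k → f ^ps k ≡ f ^ᴬ k
  ^ps≡^ᴬ f zero    = refl
  ^ps≡^ᴬ f (suc k) = cong (f *ps_) (^ps≡^ᴬ f k)

  coeffs : (P : Poly2) → Fin (List.length P) → Scalar
  coeffs P i = polyPS (List.lookup P i) , poly-polyPS (List.lookup P i)

  -- The recursion inside evalY is an inaccessible where-function; solving the
  -- metavariable by unification in evalY-∷ gives it a name.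
  mutual
    evalYFrom : Poly2 → PS → ℕ → Poly2 → PS
    evalYFrom = _

    evalY-∷ : ∀ c cs f → evalY (c ∷ cs) f ≡ (polyPS c *ps (f ^ps 0)) +ps evalYFrom (c ∷ cs) f 1 cs
    evalY-∷ c cs f with c ∷ cs | 1
    ... | P | j = refl

  evalYFrom-comb : ∀ P f j Q →
    evalYFrom P f j Q ≈ₚ comb (coeffs Q) (λ i → f ^ᴬ (j + toℕ i))
  evalYFrom-comb P f j []       m = ≡ₚ-refl
  evalYFrom-comb P f j (c ∷ cs) m = +-congₚ
    (≡⇒≡ₚ (cong (λ g → (polyPS c *ps g) m)
      (trans (^ps≡^ᴬ f j) (cong (f ^ᴬ_) (sym (+-identityʳ j))))))
    (≡ₚ-trans (evalYFrom-comb P f (suc j) cs m)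
      (comb-cong (coeffs cs) {λ i → f ^ᴬ (suc j + toℕ i)} {λ i → f ^ᴬ (j + suc (toℕ i))}
        (λ i → A.reflexive (cong (f ^ᴬ_) (sym (+-suc j (toℕ i))))) m))

  evalY-comb : ∀ P f → evalY P f ≈ₚ comb (coeffs P) (powers f)
  evalY-comb P f = evalYFrom-comb P f 0 P

  coeffs≈0⇒ZeroPoly2 : ∀ P → (∀ i → ι (coeffs P i) ≈ₚ 0ps) → ZeroPoly2 p P
  coeffs≈0⇒ZeroPoly2 []      _  = []
  coeffs≈0⇒ZeroPoly2 (c ∷ P) ≈0 = ≈0⇒zeroPoly c (≈0 zero) ∷ coeffs≈0⇒ZeroPoly2 P (≈0 ∘ suc)

theorem4p1 : (p : ℕ) → Prime p → (α : ℕ → PS) → (f : PS) →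
    NonZeroPS p f →
    (∀ k → 1 ≤ k → hasse k f ≈[ p ] (α k *ps f)) →
    InfiniteExt p α →
    Transcendental p f
theorem4p1 p p-prime α f f≢0 dlog infinite P Pf≈0 =
  coeffs≈0⇒ZeroPoly2 P (powers-independent f α f≢0 dlog infinite (List.length P) (coeffs P)
    (λ m → ≡ₚ-trans (≡ₚ-sym (evalY-comb P f m)) (Pf≈0 m)))
  where
  open Extension p p-prime
  open PrimePS p p-prime
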